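{- Let $w\in\mathfrak S_n$ and let $P_w\in\mathrm{SBT}(w)$ be the super-Yamanouchi tableau. Then for any $R\in\mathrm{SBT}(w)$ there exists a sequence $f=f_{\mathrm{inv}(R)}\cdots f_1$ of Coxeter moves (each $f_j$ some $\mathfrak c_i$ or $\mathfrak b_i$) such that $f(P_w)=R$, and for any sequence $g=g_m\cdots g_1$ of Coxeter moves with $g(P_w)=R$ we have $m\ge\mathrm{inv}(R)$.
   Context: $\ell(w)$ is the number of pairs $i<j$ with $w_i>w_j$. The Rothe diagram $\mathbb D(w)=\{(i,w_j)\mid i<j,\ w_i>w_j\}$, the cell $(i,w_j)$ lying in row $i$ (rows numbered bottom to top) and column $w_j$; it has $\ell(w)$ cells. A standard balanced tableau of shape $\mathbb D(w)$ is a bijective filling of its cells with $\{1,\ldots,\ell(w)\}$ such that for every cell, the number of cells to its right in the same row with larger entry equals the number of cells above it in the same column with smaller entry; $\mathrm{SBT}(w)$ is the set of these. The super-Yamanouchi tableau $P_w$ is the filling whose reverse row reading word (reading each row from right to left, rows from bottom to top) is $1,2,\ldots,\ell(w)$; it is a standard balanced tableau. Coxeter moves: $\mathfrak c_i$ ($1\le i<\ell(w)$) exchanges entries $i$ and $i+1$ if they are neither in the same row nor the same column, else is the identity; $\mathfrak b_i$ ($1<i<\ell(w)$) exchanges entries $i-1$ and $i+1$ if one of them lies in the same column as $i$ and above it and the other lies in the same row as $i$ and to its right, else is the identity. The inversion number $\mathrm{inv}(R)$ is the number of pairs of entries $i<j$ such that $i$ lies in a strictly higher row than $j$ and in a different column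 from $j$. -}

module Defs where

open import Data.Nat as ℕ using (ℕ; zero; suc; _+_; _∸_; _≤_)
open import Data.Nat.Properties as ℕP using ()
open import Data.Fin as Fin using (Fin)
open import Data.Fin.Properties as FinP using (any?)
open import Data.Bool using (Bool; true; false; if_then_else_; _∨_; _∧_)
open import Data.List using (List; []; _∷_; length; filter; allFin; cartesianProduct; foldl)
open import Data.List.Relation.Unary.All using (All)
open import Data.Product using (Σ; ∃; ∃-syntax; _×_; _,_; proj₁; proj₂)
open import Data.Sum using (_⊎_)
open import Relation.Nullary using (Dec; does; ¬_)
open import Relation.Nullary.Decidable using (_×-dec_; _⊎-dec_; ¬?)
open import Relation.Binary.PropositionalEquality using (_≡_)
open import Function.Definitions using (Injective)

-- Conventions.  A permutation w ∈ 𝔖_n is an injective map Fin n → Fin n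
-- (positions and values are 0-based; only their relative order matters).
-- A cell is a pair (row , column) : Fin n × Fin n.  Rows are numbered
-- bottom to top, so "above" means larger row index; "to the right"
-- means larger column index.

IsPerm : (n : ℕ) → (Fin n → Fin n) → Set
IsPerm n w = Injective _≡_ _≡_ w

count : {A : Set} {P : A → Set} → ((x : A) → Dec (P x)) → List A → ℕ
count P? xs = length (filter P? xs)

pairs : (n : ℕ) → List (Fin n × Fin n)
pairs n = cartesianProduct (allFin n) (allFin n)

ℓ : {n : ℕ} → (Fin n → Fin n) → ℕ
ℓ {n} w = count (λ p → proj₁ p Fin.<? proj₂ p ×-dec w (proj₂ p) Fin.<? w (proj₁ p)) (pairs n)

InD : {n : ℕ} → (Fin n → Fin n) → Fin n → Fin n → Set
InD w i c = ∃[ j ] (i Fin.< j × w j Fin.< w i × w j ≡ c)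

InD? : {n : ℕ} (w : Fin n → Fin n) (i c : Fin n) → Dec (InD w i c)
InD? w i c = any? (λ j → i Fin.<? j ×-dec w j Fin.<? w i ×-dec w j Fin.≟ c)

-- A filling: (row , column) ↦ entry.  Only values on cells of 𝔻(w) matter.
Filling : ℕ → Set
Filling n = Fin n → Fin n → ℕ

_≈[_]_ : {n : ℕ} → Filling n → (Fin n → Fin n) → Filling n → Set
T ≈[ w ] R = ∀ i c → InD w i c → T i c ≡ R i c

rightLarger : {n : ℕ} → (Fin n → Fin n) → Filling n → Fin n → Fin n → ℕ
rightLarger {n} w T i c =
  count (λ c' → c Fin.<? c' ×-dec InD? w i c' ×-dec T i c ℕ.<? T i c') (allFin n)

aboveSmaller : {n : ℕ} → (Fin n → Fin n) → Filling n → Fin n → Fin n → ℕ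
aboveSmaller {n} w T i c =
  count (λ i' → i Fin.<? i' ×-dec InD? w i' c ×-dec T i' c ℕ.<? T i c) (allFin n)

record IsSBT {n : ℕ} (w : Fin n → Fin n) (T : Filling n) : Set where
  field
    inRange   : ∀ i c → InD w i c → 1 ≤ T i c × T i c ≤ ℓ w
    injective : ∀ i c i' c' → InD w i c → InD w i' c' → T i c ≡ T i' c' → (i ≡ i' × c ≡ c')
    surjective : ∀ k → 1 ≤ k → k ≤ ℓ w → ∃[ i ] ∃[ c ] (InD w i c × T i c ≡ k)
    balanced  : ∀ i c → InD w i c → rightLarger w T i c ≡ aboveSmaller w T i c

-- super-Yamanouchi tableau: reverse row reading word (rows bottom to top,
-- each row right to left) is 1, 2, …, ℓ(w).  The entry of a cell is the
-- number of diagram cells read up to and including it.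
superYamanouchi : {n : ℕ} → (Fin n → Fin n) → Filling n
superYamanouchi {n} w i c =
  count (λ p → InD? w (proj₁ p) (proj₂ p) ×-dec
               (proj₁ p Fin.<? i ⊎-dec (proj₁ p Fin.≟ i ×-dec c Fin.≤? proj₂ p)))
        (pairs n)

inv : {n : ℕ} → (Fin n → Fin n) → Filling n → ℕ
inv {n} w T =
  count (λ pq → let p = proj₁ pq ; q = proj₂ pq in
           InD? w (proj₁ p) (proj₂ p) ×-dec InD? w (proj₁ q) (proj₂ q) ×-dec
           T (proj₁ p) (proj₂ p) ℕ.<? T (proj₁ q) (proj₂ q) ×-dec
           proj₁ q Fin.<? proj₁ p ×-dec ¬? (proj₂ p Fin.≟ proj₂ q))
        (cartesianProduct (pairs n) (pairs n))

SameRow : {n : ℕ} → (Fin n → Fin n) → Filling n → ℕ → ℕ → Set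
SameRow w T a b = ∃[ i ] ∃[ c ] ∃[ c' ] (InD w i c × InD w i c' × T i c ≡ a × T i c' ≡ b)

SameRow? : {n : ℕ} (w : Fin n → Fin n) (T : Filling n) (a b : ℕ) → Dec (SameRow w T a b)
SameRow? w T a b = any? λ i → any? λ c → any? λ c' →
  InD? w i c ×-dec InD? w i c' ×-dec T i c ℕ.≟ a ×-dec T i c' ℕ.≟ b

SameCol : {n : ℕ} → (Fin n → Fin n) → Filling n → ℕ → ℕ → Set
SameCol w T a b = ∃[ c ] ∃[ i ] ∃[ i' ] (InD w i c × InD w i' c × T i c ≡ a × T i' c ≡ b)

SameCol? : {n : ℕ} (w : Fin n → Fin n) (T : Filling n) (a b : ℕ) → Dec (SameCol w T a b)
SameCol? w T a b = any? λ c → any? λ i → any? λ i' →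
  InD? w i c ×-dec InD? w i' c ×-dec T i c ℕ.≟ a ×-dec T i' c ℕ.≟ b

AboveOf : {n : ℕ} → (Fin n → Fin n) → Filling n → ℕ → ℕ → Set
AboveOf w T a b = ∃[ c ] ∃[ i ] ∃[ i' ]
  (InD w i c × InD w i' c × i Fin.< i' × T i c ≡ b × T i' c ≡ a)

AboveOf? : {n : ℕ} (w : Fin n → Fin n) (T : Filling n) (a b : ℕ) → Dec (AboveOf w T a b)
AboveOf? w T a b = any? λ c → any? λ i → any? λ i' →
  InD? w i c ×-dec InD? w i' c ×-dec i Fin.<? i' ×-dec T i c ℕ.≟ b ×-dec T i' c ℕ.≟ a

RightOf : {n : ℕ} → (Fin n → Fin n) → Filling n → ℕ → ℕ → Set
RightOf w T a b = ∃[ i ] ∃[ c ] ∃[ c' ]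
  (InD w i c × InD w i c' × c Fin.< c' × T i c ≡ b × T i c' ≡ a)

RightOf? : {n : ℕ} (w : Fin n → Fin n) (T : Filling n) (a b : ℕ) → Dec (RightOf w T a b)
RightOf? w T a b = any? λ i → any? λ c → any? λ c' →
  InD? w i c ×-dec InD? w i c' ×-dec c Fin.<? c' ×-dec T i c ℕ.≟ b ×-dec T i c' ℕ.≟ a

swapEntries : {n : ℕ} → ℕ → ℕ → Filling n → Filling n
swapEntries a b T i c =
  if does (T i c ℕ.≟ a) then b else (if does (T i c ℕ.≟ b) then a else T i c)

data Move : Set where
  𝔠 : ℕ → Move
  𝔟 : ℕ → Move

ValidMove : {n : ℕ} → (Fin n → Fin n) → Move → Set
ValidMove w (𝔠 k) = 1 ≤ k × k ℕ.< ℓ w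
ValidMove w (𝔟 k) = 1 ℕ.< k × k ℕ.< ℓ w

applyMove : {n : ℕ} → (Fin n → Fin n) → Move → Filling n → Filling n
applyMove w (𝔠 k) T =
  if does (SameRow? w T k (suc k) ⊎-dec SameCol? w T k (suc k))
  then T else swapEntries k (suc k) T
applyMove w (𝔟 k) T =
  if does ((AboveOf? w T (k ∸ 1) k ×-dec RightOf? w T (suc k) k) ⊎-dec
           (AboveOf? w T (suc k) k ×-dec RightOf? w T (k ∸ 1) k))
  then swapEntries (k ∸ 1) (suc k) T else T

-- a sequence f = f_m ⋯ f_1 is given as the list [ f_1 , … , f_m ];
-- f_1 is applied first
applyMoves : {n : ℕ} → (Fin n → Fin n) → List Move → Filling n → Filling n
applyMoves w fs T = foldl (λ S f → applyMove w f S) T fs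

{-# OPTIONS --safe #-}
-- Each Coxeter move reverses at most one pair seen by inv, so inv changes by at most one per
-- move; as inv (P_w) = 0 this gives the lower bound.  Conversely every R ≠ P_w admits a move
-- that lowers inv and stays within SBT(w).  To find it, take the last k such that k + 1 lies in
-- a lower row than k.  If their columns differ, 𝔠ₖ works.  If they share a column, then 𝔟ₖ₊₁
-- works: k + 2 lies to the right of k + 1.  This last claim uses that a balanced tableau is a
-- chain of permutations from the identity to w, that is, that at each time "w a stands left of
-- w b" is transitive.  If there is no such k then balance forces R = P_w.
module Submission where

open import Defs
open import Data.Bool using (Bool; true; false; if_then_else_)
open import Data.Empty using (⊥; ⊥-elim)
open import Data.Fin as Fin using (Fin; toℕ)
open import Data.Fin.Properties as Finₚ using (toℕ-injective; toℕ<n)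
open import Data.List using (List; []; _∷_; [_]; _++_; _∷ʳ_; length; filter; allFin; cartesianProduct)
open import Data.List.Membership.Propositional using (_∈_; find; lose)
open import Data.List.Membership.Propositional.Properties using (∈-∃++; ∈-++⁻; ∈-++⁺ˡ; ∈-++⁺ʳ; ∈-filter⁺; ∈-filter⁻; ∈-allFin; ∈-cartesianProduct⁺)
open import Data.List.Properties using (length-++; length-tabulate; foldl-++)
open import Data.List.Relation.Unary.All as All using (All; []; _∷_)
open import Data.List.Relation.Unary.All.Properties using (∷ʳ⁺)
open import Data.List.Relation.Unary.AllPairs using ([]; _∷_)
open import Data.List.Relation.Unary.Any using (here; there; any?)
open import Data.List.Relation.Unary.Unique.Propositional using (Unique)
import Data.List.Relation.Unary.Unique.Propositional.Properties as Unique
open import Data.Nat using (ℕ; zero; suc; _+_; _∸_; _≤_; _<_; z≤n; s≤s; _≟_; _<?_; _≤?_)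
open import Data.Nat.Properties
open import Data.Product as Prod using (∃-syntax; _×_; _,_; proj₁; proj₂)
open import Data.Sum as Sum using (_⊎_; inj₁; inj₂; [_,_]′)
open import Function using (_∘_; id; mk⇔)
open import Relation.Binary.Definitions using (tri<; tri≈; tri>)
open import Relation.Binary.PropositionalEquality using (_≡_; _≢_; refl; sym; trans; cong; subst; subst₂)
open import Relation.Nullary using (Dec; yes; no; does; ¬_; contradiction)
open import Relation.Nullary.Decidable using (_×-dec_; _⊎-dec_; ¬?; dec-true; dec-false; does-⇔; decidable-stable)

-- Counting

-- Balance is a count at a single cell, while the claim about `2 + k` compares several values at
-- several times. Transitivity bridges the two, and is itself obtained by counting: a violation
-- makes one of the two counts at some cell strictly smaller than the other. Let `k` and `1 + k` lie
-- in the column `w x`, in rows `y` above `z`. Transitivity for `y`, `x`, `z` shows that the cell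
-- `(z , w y)` exists and has an entry of at least `2 + k`. As `k` is the last descent, rows rise
-- from `1 + k` on, which traps `2 + k` in row `z`; further uses of transitivity find its column.
-- That a move changes `inv` by at most one rests on `inv` ignoring pairs in a common row or column:
-- `𝔟` also disturbs comparisons with the middle entry, but this entry is collinear with both
-- exchanged ones.

remove : {A : Set} {y : A} {ys : List A} → y ∈ ys →
         ∃[ zs ] (length ys ≡ suc (length zs) × (∀ {v} → v ∈ ys → v ≢ y → v ∈ zs))
remove {y = y} y∈ys with ∈-∃++ y∈ys
... | us , vs , refl = us ++ vs , len , keep
  where
  len : length (us ++ [ y ] ++ vs) ≡ suc (length (us ++ vs))
  len = trans (length-++ us)
          (trans (+-suc (length us) (length vs)) (cong suc (sym (length-++ us))))
  keep : ∀ {v} → v ∈ us ++ [ y ] ++ vs → v ≢ y → v ∈ us ++ vs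
  keep v∈ v≢y with ∈-++⁻ us v∈
  ... | inj₁ v∈us          = ∈-++⁺ˡ v∈us
  ... | inj₂ (here v≡y)    = contradiction v≡y v≢y
  ... | inj₂ (there v∈vs)  = ∈-++⁺ʳ us v∈vs

-- Matchings are relations rather than functions, so that a column `c` and an index `j` can be
-- matched by `c ≡ w j` in either direction without inverting `w`.
LeftInjective : {A B : Set} → (A → B → Set) → Set
LeftInjective _∼_ = ∀ {x x′ y} → x ∼ y → x′ ∼ y → x ≡ x′

≡-leftInjective : {A : Set} → LeftInjective {A} _≡_
≡-leftInjective x≡y x′≡y = trans x≡y (sym x′≡y)

length-≤ : {A B : Set} (_∼_ : A → B → Set) → LeftInjective _∼_ →
           {xs : List A} {ys : List B} → Unique xs →
           (∀ {x} → x ∈ xs → ∃[ y ] (y ∈ ys × x ∼ y)) → length xs ≤ length ys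
length-≤ _∼_ inj [] _ = z≤n
length-≤ _∼_ inj {x ∷ xs} {ys} (x∉xs ∷ uniq) f with f (here refl)
... | y , y∈ys , x∼y with remove y∈ys
... | zs , len , keep = subst (suc (length xs) ≤_) (sym len) (s≤s (length-≤ _∼_ inj uniq g))
  where
  g : ∀ {x′} → x′ ∈ xs → ∃[ z ] (z ∈ zs × x′ ∼ z)
  g x′∈xs with f (there x′∈xs)
  ... | z , z∈ys , x′∼z =
    z , keep z∈ys (λ { refl → All.lookup x∉xs x′∈xs (inj x∼y x′∼z) }) , x′∼z

length-< : {A B : Set} (_∼_ : A → B → Set) → LeftInjective _∼_ →
           {xs : List A} {ys : List B} → Unique xs →
           (∀ {x} → x ∈ xs → ∃[ y ] (y ∈ ys × x ∼ y)) →
           ∀ {y₀} → y₀ ∈ ys → (∀ {x} → x ∈ xs → ¬ (x ∼ y₀)) → length xs < length ys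
length-< _∼_ inj {xs} uniq f y₀∈ys miss with remove y₀∈ys
... | zs , len , keep = subst (length xs <_) (sym len) (s≤s (length-≤ _∼_ inj uniq g))
  where
  g : ∀ {x} → x ∈ xs → ∃[ z ] (z ∈ zs × x ∼ z)
  g x∈xs with f x∈xs
  ... | z , z∈ys , x∼z = z , keep z∈ys (λ { refl → miss x∈xs x∼z }) , x∼z

IsEnumeration : {A : Set} → List A → Set
IsEnumeration xs = Unique xs × (∀ x → x ∈ xs)

allFin-enum : ∀ n → IsEnumeration (allFin n)
allFin-enum n = Unique.allFin⁺ n , ∈-allFin

×-enum : {A B : Set} {xs : List A} {ys : List B} → IsEnumeration xs → IsEnumeration ys →
         IsEnumeration (cartesianProduct xs ys)
×-enum (ux , cx) (uy , cy) =
  Unique.cartesianProduct⁺ ux uy , λ { (x , y) → ∈-cartesianProduct⁺ (cx x) (cy y) }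

pairs-enum : ∀ n → IsEnumeration (pairs n)
pairs-enum n = ×-enum (allFin-enum n) (allFin-enum n)

module _ {A B : Set} {P : A → Set} {Q : B → Set} (P? : ∀ x → Dec (P x)) (Q? : ∀ y → Dec (Q y))
         {xs : List A} {ys : List B} (enumˣ : IsEnumeration xs) (enumʸ : IsEnumeration ys)
         (_∼_ : A → B → Set) (inj : LeftInjective _∼_)
         (f : ∀ {x} → P x → ∃[ y ] (Q y × x ∼ y)) where

  private
    f′ : ∀ {x} → x ∈ filter P? xs → ∃[ y ] (y ∈ filter Q? ys × x ∼ y)
    f′ x∈ with f (proj₂ (∈-filter⁻ P? {xs = xs} x∈))
    ... | y , Qy , x∼y = y , ∈-filter⁺ Q? (proj₂ enumʸ y) Qy , x∼y

  count-inj-≤ : count P? xs ≤ count Q? ys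
  count-inj-≤ = length-≤ _∼_ inj (Unique.filter⁺ P? (proj₁ enumˣ)) f′

  count-inj-< : ∀ {y₀} → Q y₀ → (∀ {x} → P x → ¬ (x ∼ y₀)) → count P? xs < count Q? ys
  count-inj-< Qy₀ miss =
    length-< _∼_ inj (Unique.filter⁺ P? (proj₁ enumˣ)) f′
      (∈-filter⁺ Q? (proj₂ enumʸ _) Qy₀) (miss ∘ proj₂ ∘ ∈-filter⁻ P? {xs = xs})

module _ {A : Set} {P Q : A → Set} (P? : ∀ x → Dec (P x)) (Q? : ∀ x → Dec (Q x))
         {xs : List A} (enum : IsEnumeration xs) where

  count-⊆ : (∀ {x} → P x → Q x) → count P? xs ≤ count Q? xs
  count-⊆ P⊆Q = count-inj-≤ P? Q? enum enum _≡_ ≡-leftInjective (λ Px → _ , P⊆Q Px , refl)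

  count-⊂ : (∀ {x} → P x → Q x) → ∀ {y} → Q y → ¬ P y → count P? xs < count Q? xs
  count-⊂ P⊆Q Qy ¬Py =
    count-inj-< P? Q? enum enum _≡_ ≡-leftInjective (λ Px → _ , P⊆Q Px , refl)
      Qy (λ { Px refl → ¬Py Px })

  count-⊆-but-one : (∀ {x y} → P x → ¬ Q x → P y → ¬ Q y → x ≡ y) →
                    count P? xs ≤ suc (count Q? xs)
  count-⊆-but-one one with any? (λ x → P? x ×-dec ¬? (Q? x)) xs
  ... | no none = ≤-trans (count-⊆ sub) (n≤1+n _)
    where
    sub : ∀ {x} → P x → Q x
    sub {x} Px with Q? x
    ... | yes Qx = Qx
    ... | no ¬Qx = contradiction (lose (proj₂ enum x) (Px , ¬Qx)) none
  ... | yes some with find some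
  ... | x₀ , _ , Px₀ , ¬Qx₀ =
    length-≤ _≡_ ≡-leftInjective {ys = x₀ ∷ _} (Unique.filter⁺ P? (proj₁ enum)) g
    where
    g : ∀ {x} → x ∈ filter P? xs → ∃[ y ] (y ∈ x₀ ∷ filter Q? xs × x ≡ y)
    g {x} x∈ with Q? x
    ... | yes Qx = x , there (∈-filter⁺ Q? (proj₂ enum x) Qx) , refl
    ... | no ¬Qx = x , here (one (proj₂ (∈-filter⁻ P? {xs = xs} x∈)) ¬Qx Px₀ ¬Qx₀) , refl

count-suc : {A : Set} {P Q : A → Set} (P? : ∀ x → Dec (P x)) (Q? : ∀ x → Dec (Q x))
            {xs : List A} → IsEnumeration xs → (∀ {x} → P x → Q x) →
            (∀ {x y} → Q x → ¬ P x → Q y → ¬ P y → x ≡ y) →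
            ∀ {y} → Q y → ¬ P y → suc (count P? xs) ≡ count Q? xs
count-suc P? Q? enum P⊆Q one Qy ¬Py =
  ≤-antisym (count-⊂ P? Q? enum P⊆Q Qy ¬Py) (count-⊆-but-one Q? P? enum one)

count-cong : {A : Set} {P Q : A → Set} (P? : ∀ x → Dec (P x)) (Q? : ∀ x → Dec (Q x))
             {xs : List A} → IsEnumeration xs → (∀ {x} → P x → Q x) → (∀ {x} → Q x → P x) →
             count P? xs ≡ count Q? xs
count-cong P? Q? enum P⊆Q Q⊆P =
  ≤-antisym (count-⊆ P? Q? enum P⊆Q) (count-⊆ Q? P? enum Q⊆P)

count-none : {A : Set} {P : A → Set} (P? : ∀ x → Dec (P x)) (xs : List A) →
             (∀ {x} → ¬ P x) → count P? xs ≡ 0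
count-none P? [] none = refl
count-none P? (x ∷ xs) none with P? x
... | yes Px = contradiction Px none
... | no _   = count-none P? xs none

count-none⁻ : {A : Set} {P : A → Set} (P? : ∀ x → Dec (P x)) {xs : List A} →
              IsEnumeration xs → count P? xs ≡ 0 → ∀ {x} → ¬ P x
count-none⁻ P? {xs} enum eq {x} Px
  with filter P? xs | ∈-filter⁺ P? (proj₂ enum x) Px
count-none⁻ P? enum () {x} Px | _ ∷ _ | _

-- The order of the values at a given time

-- A balanced tableau is read as a path from the identity to w in which the values w i > w j
-- with i < j trade places at time T i (w j).  Before t a b says that w a stands to the left
-- of w b when exactly the trades with entry less than t have been made.
module _ {n : ℕ} (w : Fin n → Fin n) (T : Filling n) where

  Before : ℕ → Fin n → Fin n → Set
  Before t a b = (w b Fin.< w a × a Fin.< b × T a (w b) < t)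
               ⊎ (w a Fin.< w b × ¬ (b Fin.< a × T b (w a) < t))

  Before? : ∀ t a b → Dec (Before t a b)
  Before? t a b = (w b Fin.<? w a ×-dec a Fin.<? b ×-dec T a (w b) <? t)
            ⊎-dec (w a Fin.<? w b ×-dec ¬? (b Fin.<? a ×-dec T b (w a) <? t))

  before-asym : ∀ {t a b} → Before t a b → ¬ Before t b a
  before-asym (inj₁ (wb<wa , _)) (inj₁ (wa<wb , _)) = <-asym wb<wa wa<wb
  before-asym (inj₁ (_ , ab))    (inj₂ (_ , ¬ab))   = ¬ab ab
  before-asym (inj₂ (_ , ¬ba))   (inj₁ (_ , ba))    = ¬ba ba
  before-asym (inj₂ (wa<wb , _)) (inj₂ (wb<wa , _)) = <-asym wb<wa wa<wb

  before-irrefl : ∀ {t a} → ¬ Before t a a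
  before-irrefl b = before-asym b b

  before-total : IsPerm n w → ∀ {t a b} → a ≢ b → ¬ Before t a b → Before t b a
  before-total perm {t} {a} {b} a≢b ¬ab with Finₚ.<-cmp (w a) (w b)
  ... | tri≈ _ wa≡wb _ = contradiction (perm wa≡wb) a≢b
  ... | tri> _ _ wb<wa = inj₂ (wb<wa , λ ab → ¬ab (inj₁ (wb<wa , ab)))
  ... | tri< wa<wb _ _ with b Fin.<? a ×-dec T b (w a) <? t
  ...   | yes ba = inj₁ (wa<wb , ba)
  ...   | no ¬ba = contradiction (inj₂ (wa<wb , ¬ba)) ¬ab

  -- The only trade at time `t` that can newly put `w a` to the left of `w b` is that of the cell
  -- `(a , w b)`; excluding this one cell carries the order back by one unit of time.
  before-suc⁻ : ∀ {t a b} → (InD w a (w b) → T a (w b) ≢ t) → Before (suc t) a b → Before t a b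
  before-suc⁻ ≢t (inj₁ (wb<wa , a<b , s≤s ≤t)) =
    inj₁ (wb<wa , a<b , ≤∧≢⇒< ≤t (≢t (_ , a<b , wb<wa , refl)))
  before-suc⁻ _ (inj₂ (wa<wb , ¬ba)) =
    inj₂ (wa<wb , λ { (b<a , <t) → ¬ba (b<a , m<n⇒m<1+n <t) })

  before-suc⁺ : ∀ {t a b} → (InD w b (w a) → T b (w a) ≢ t) → Before t a b → Before (suc t) a b
  before-suc⁺ _ (inj₁ (wb<wa , a<b , <t)) = inj₁ (wb<wa , a<b , m<n⇒m<1+n <t)
  before-suc⁺ ≢t (inj₂ (wa<wb , ¬ba)) = inj₂ (wa<wb ,
    λ { (b<a , s≤s ≤t) → ¬ba (b<a , ≤∧≢⇒< ≤t (≢t (_ , b<a , wa<wb , refl))) })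

  TransitiveFrom : ℕ → Set
  TransitiveFrom k = ∀ {t a b c} → k ≤ toℕ a → k ≤ toℕ b → k ≤ toℕ c →
                     Before t a b → Before t b c → Before t a c

  IsBalanced : Set
  IsBalanced = ∀ i c → InD w i c → rightLarger w T i c ≡ aboveSmaller w T i c

-- Balance implies transitivity

module _ {n : ℕ} {w : Fin n → Fin n} (perm : IsPerm n w) {T : Filling n}
         (balanced : IsBalanced w T) where

  -- Balance of a row involves only that row and the rows above it, so transitivity is proved
  -- one row at a time, from the top.  For the new row z it says that the values which z has
  -- not yet passed at time t form an initial segment of the arrangement of the later values.
  module _ (z : Fin n) (IH : TransitiveFrom w T (suc (toℕ z))) (t : ℕ) where

    Uncrossed : Fin n → Set
    Uncrossed a = w a Fin.< w z × z Fin.< a × t ≤ T z (w a)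

    Uncrossed? : ∀ a → Dec (Uncrossed a)
    Uncrossed? a = w a Fin.<? w z ×-dec z Fin.<? a ×-dec t ≤? T z (w a)

    -- A misplaced pair with `w y < w v` breaks balance at the cell `(z , w y)`. Each `w j` counted
    -- to the right is uncrossed, so it stands before `w v` and hence before `w y`; the trade in
    -- `(j , w y)` is therefore earlier than `t`, and row `j` is counted above. Row `v` is counted
    -- above too, but has no partner on the right because `v` is not `Uncrossed`.
    rightLarger<aboveSmaller : ∀ {y v} → z Fin.< y → z Fin.< v → Uncrossed y → ¬ Uncrossed v →
      w y Fin.< w v → Before w T t v y →
      (∀ {u} → w y Fin.< w u → Uncrossed u → Before w T t u v) →
      rightLarger w T z (w y) < aboveSmaller w T z (w y)
    rightLarger<aboveSmaller z<y z<v _ _ wy<wv (inj₂ (wv<wy , _)) _ =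
      contradiction wy<wv (<-asym wv<wy)
    rightLarger<aboveSmaller {y} {v} z<y z<v (_ , _ , t≤zy) ¬Uv wy<wv
                             v⋖y@(inj₁ (_ , v<y , vy<t)) before-v =
      count-inj-<
        (λ c → w y Fin.<? c ×-dec InD? w z c ×-dec T z (w y) <? T z c)
        (λ i → z Fin.<? i ×-dec InD? w i (w y) ×-dec T i (w y) <? T z (w y))
        (allFin-enum n) (allFin-enum n)
        (λ c j → c ≡ w j) (λ c≡ c′≡ → trans c≡ (sym c′≡)) f
        (z<v , (y , v<y , wy<wv , refl) , ≤-trans vy<t t≤zy)
        (λ { (_ , (j , z<j , wj<wz , refl) , zy<zj) wj≡wv →
             ¬Uv (subst Uncrossed (perm wj≡wv) (wj<wz , z<j , <⇒≤ (≤-<-trans t≤zy zy<zj))) })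
      where
      f : ∀ {c} → w y Fin.< c × InD w z c × T z (w y) < T z c →
          ∃[ j ] ((z Fin.< j × InD w j (w y) × T j (w y) < T z (w y)) × c ≡ w j)
      f (wy<wj , (j , z<j , wj<wz , refl) , zy<zj)
        with IH z<j z<v z<y (before-v wy<wj (wj<wz , z<j , <⇒≤ (≤-<-trans t≤zy zy<zj))) v⋖y
      ... | inj₁ (_ , j<y , jy<t) =
            j , (z<j , (y , j<y , wy<wj , refl) , ≤-trans jy<t t≤zy) , refl
      ... | inj₂ (wj<wy , _) = contradiction wy<wj (<-asym wj<wy)

    -- The mirror case, at the cell `(z , w v)`, whose entry is less than `t`. A row `j` counted
    -- above has `w j` before `w v`, hence before `w y`; so `j` must be uncrossed, and `w j` is
    -- counted on the right. The column `w y` is the surplus one: `w y` stands after `w v`, so row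
    -- `y` is not counted above.
    aboveSmaller<rightLarger : ∀ {y v} → z Fin.< y → z Fin.< v → Uncrossed y → ¬ Uncrossed v →
      w v Fin.< w y → Before w T t v y →
      (∀ {u} → z Fin.< u → w v Fin.< w u → ¬ Uncrossed u → Before w T t y u) →
      aboveSmaller w T z (w v) < rightLarger w T z (w v)
    aboveSmaller<rightLarger {y} {v} z<y z<v (wy<wz , _ , t≤zy) ¬Uv wv<wy v⋖y y-before =
      count-inj-<
        (λ i → z Fin.<? i ×-dec InD? w i (w v) ×-dec T i (w v) <? T z (w v))
        (λ c → w v Fin.<? c ×-dec InD? w z c ×-dec T z (w v) <? T z c)
        (allFin-enum n) (allFin-enum n)
        (λ j c → c ≡ w j) (λ c≡ c≡′ → perm (trans (sym c≡) c≡′)) f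
        (wv<wy , (y , z<y , wy<wz , refl) , ≤-trans zv<t t≤zy)
        miss
      where
      zv<t : T z (w v) < t
      zv<t = ≰⇒> (λ t≤zv → ¬Uv (<-trans wv<wy wy<wz , z<v , t≤zv))
      above : ∀ {i} → InD w i (w v) → T i (w v) < T z (w v) → w v Fin.< w i × Before w T t i v
      above {i} (j , i<j , wj<wi , wj≡wv) iv<zv with perm wj≡wv
      ... | refl = wj<wi , inj₁ (wj<wi , i<j , <-trans iv<zv zv<t)
      miss : ∀ {j} → z Fin.< j × InD w j (w v) × T j (w v) < T z (w v) → ¬ (w y ≡ w j)
      miss (_ , d , jv<zv) wy≡wj with perm wy≡wj
      ... | refl = before-asym w T (proj₂ (above d jv<zv)) v⋖y
      f : ∀ {j} → z Fin.< j × InD w j (w v) × T j (w v) < T z (w v) →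
          ∃[ c ] ((w v Fin.< c × InD w z c × T z (w v) < T z c) × c ≡ w j)
      f {j} (z<j , d , jv<zv) with above d jv<zv | Uncrossed? j
      ... | wv<wj , j⋖v | no ¬Uj =
            contradiction (IH z<j z<v z<y j⋖v v⋖y) (before-asym w T (y-before z<j wv<wj ¬Uj))
      ... | wv<wj , j⋖v | yes (wj<wz , _ , t≤zj) =
            w j , (wv<wj , (j , z<j , wj<wz , refl) , ≤-trans zv<t t≤zj) , refl

    -- Induction downwards on the smaller of `w y` and `w v`: the counting at the cell in that
    -- column appeals only to pairs whose values both exceed it. `k` bounds the two values from
    -- below and `m` is the fuel; with no fuel left `k` would be at least `n`.
    uncrossed-initial-from : ∀ m k → n ≤ m + k → ∀ {y v} → z Fin.< v → k ≤ toℕ (w y) → k ≤ toℕ (w v) →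
                             Uncrossed y → ¬ Uncrossed v → Before w T t y v
    uncrossed-initial-from zero k n≤k {y} _ k≤wy _ _ _ =
      contradiction (toℕ<n (w y)) (≤⇒≯ (≤-trans n≤k k≤wy))
    uncrossed-initial-from (suc m) k n≤ {y} {v} z<v k≤wy k≤wv Uy@(wy<wz , z<y , _) ¬Uv
      with Before? w T t y v
    ... | yes y⋖v = y⋖v
    ... | no ¬y⋖v = contradiction (before-total w T perm (λ { refl → ¬Uv Uy }) ¬y⋖v) absurd
      where
      rec : ∀ {y v} → z Fin.< v → k < toℕ (w y) → k < toℕ (w v) →
            Uncrossed y → ¬ Uncrossed v → Before w T t y v
      rec = uncrossed-initial-from m (suc k) (subst (n ≤_) (sym (+-suc m k)) n≤)
      absurd : ¬ Before w T t v y
      absurd v⋖y with Finₚ.<-cmp (w y) (w v)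
      ... | tri≈ _ wy≡wv _ = ¬Uv (subst Uncrossed (perm wy≡wv) Uy)
      ... | tri< wy<wv _ _ =
            <-irrefl (balanced z (w y) (y , z<y , wy<wz , refl))
              (rightLarger<aboveSmaller z<y z<v Uy ¬Uv wy<wv v⋖y
                (λ wy<wu Uu → rec z<v (≤-<-trans k≤wy wy<wu) (≤-<-trans k≤wy wy<wv) Uu ¬Uv))
      ... | tri> _ _ wv<wy =
            <-irrefl (sym (balanced z (w v) (v , z<v , <-trans wv<wy wy<wz , refl)))
              (aboveSmaller<rightLarger z<y z<v Uy ¬Uv wv<wy v⋖y
                (λ z<u wv<wu ¬Uu → rec z<u (≤-<-trans k≤wv wv<wy) (≤-<-trans k≤wv wv<wu) Uy ¬Uu))

    uncrossed-initial : ∀ {y v} → z Fin.< v → Uncrossed y → ¬ Uncrossed v → Before w T t y v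
    uncrossed-initial z<v = uncrossed-initial-from n 0 (m≤m+n n 0) z<v z≤n z≤n

    before⇒uncrossed : ∀ {a} → z Fin.< a → Before w T t a z → Uncrossed a
    before⇒uncrossed z<a (inj₁ (_ , a<z , _))   = contradiction z<a (<-asym a<z)
    before⇒uncrossed z<a (inj₂ (wa<wz , ¬za)) = wa<wz , z<a , ≮⇒≥ (λ za<t → ¬za (z<a , za<t))

    uncrossed⇒before : ∀ {a} → Uncrossed a → Before w T t a z
    uncrossed⇒before (wa<wz , _ , t≤za) = inj₂ (wa<wz , λ { (_ , za<t) → ≤⇒≯ t≤za za<t })

    ¬uncrossed⇒after : ∀ {a} → z Fin.< a → ¬ Uncrossed a → Before w T t z a
    ¬uncrossed⇒after z<a ¬Ua =
      before-total w T perm (λ a≡z → Finₚ.<-irrefl (sym a≡z) z<a) (¬Ua ∘ before⇒uncrossed z<a)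

    after⇒¬uncrossed : ∀ {a} → Before w T t z a → ¬ Uncrossed a
    after⇒¬uncrossed z⋖a Ua = before-asym w T z⋖a (uncrossed⇒before Ua)

    past : ∀ {a} → toℕ z ≤ toℕ a → a ≢ z → z Fin.< a
    past z≤a a≢z = ≤∧≢⇒< z≤a (a≢z ∘ sym ∘ toℕ-injective)

    -- If exactly one of the three is `z`, the claim is the initial-segment property read from one
    -- of its three sides; if none is, it concerns later indices only and `IH` applies.
    transitiveFrom-step : ∀ {a b c} → toℕ z ≤ toℕ a → toℕ z ≤ toℕ b → toℕ z ≤ toℕ c →
                          Before w T t a b → Before w T t b c → Before w T t a c
    transitiveFrom-step {a} {b} {c} z≤a z≤b z≤c a⋖b b⋖c
      with a Fin.≟ z | b Fin.≟ z | c Fin.≟ z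
    ... | yes refl | yes refl | _        = contradiction a⋖b (before-irrefl w T)
    ... | yes refl | no _     | yes refl = contradiction b⋖c (before-asym w T a⋖b)
    ... | no _     | yes refl | yes refl = contradiction b⋖c (before-irrefl w T)
    ... | yes refl | no b≢z   | no c≢z   = ¬uncrossed⇒after (past z≤c c≢z) λ Uc →
          before-asym w T b⋖c (uncrossed-initial (past z≤b b≢z) Uc (after⇒¬uncrossed a⋖b))
    ... | no a≢z   | yes refl | no c≢z   =
          uncrossed-initial (past z≤c c≢z)
            (before⇒uncrossed (past z≤a a≢z) a⋖b) (after⇒¬uncrossed b⋖c)
    ... | no a≢z   | no b≢z   | yes refl = uncrossed⇒before (decidable-stable (Uncrossed? a) λ ¬Ua →
          before-asym w T a⋖b (uncrossed-initial (past z≤a a≢z)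
            (before⇒uncrossed (past z≤b b≢z) b⋖c) ¬Ua))
    ... | no a≢z   | no b≢z   | no c≢z   =
          IH (past z≤a a≢z) (past z≤b b≢z)
             (past z≤c c≢z) a⋖b b⋖c

  transitiveFrom : ∀ m k → n ≤ m + k → TransitiveFrom w T k
  transitiveFrom zero k n≤k {a = a} k≤a =
    contradiction (toℕ<n a) (≤⇒≯ (≤-trans n≤k k≤a))
  transitiveFrom (suc m) k n≤ {t} {a} {b} {c} k≤a k≤b k≤c =
    transitiveFrom-step z IH t (z≤ k≤a) (z≤ k≤b) (z≤ k≤c)
    where
    k<n : k < n
    k<n = ≤-<-trans k≤a (toℕ<n a)
    z : Fin n
    z = Fin.fromℕ< k<n
    z≡k : toℕ z ≡ k
    z≡k = Finₚ.toℕ-fromℕ< k<n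
    z≤ : ∀ {x} → k ≤ x → toℕ z ≤ x
    z≤ = subst (_≤ _) (sym z≡k)
    IH : TransitiveFrom w T (suc (toℕ z))
    IH = subst (TransitiveFrom w T ∘ suc) (sym z≡k)
           (transitiveFrom m (suc k) (subst (n ≤_) (sym (+-suc m k)) n≤))

  before-trans : ∀ {t a b c} → Before w T t a b → Before w T t b c → Before w T t a c
  before-trans = transitiveFrom n 0 (m≤m+n n 0) z≤n z≤n z≤n

InjectiveOn : {n : ℕ} → (Fin n → Fin n) → Filling n → Set
InjectiveOn w T = ∀ i c i′ c′ → InD w i c → InD w i′ c′ → T i c ≡ T i′ c′ → i ≡ i′ × c ≡ c′

-- Consecutive entries in one column, the larger one below

module _ {n : ℕ} {w : Fin n → Fin n} (perm : IsPerm n w) {T : Filling n}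
         (balanced : IsBalanced w T) (injective : InjectiveOn w T)
         {x y z : Fin n} {k : ℕ} (z<y : z Fin.< y) (y<x : y Fin.< x)
         (wx<wy : w x Fin.< w y) (wx<wz : w x Fin.< w z)
         (yx≡k : T y (w x) ≡ k) (zx≡1+k : T z (w x) ≡ suc k) where

  private
    infix 4 _⟨_⟩_
    _⟨_⟩_ : Fin n → ℕ → Fin n → Set
    a ⟨ t ⟩ b = Before w T t a b

    z<x : z Fin.< x
    z<x = <-trans z<y y<x

    dʸ : InD w y (w x)
    dʸ = x , y<x , wx<wy , refl

    dᶻ : InD w z (w x)
    dᶻ = x , z<x , wx<wz , refl

  -- At time `suc k`, between the two trades, `w y` stands before `w x` and `w x` before `w z`. So
  -- `w y` stands before `w z`, and since `z < y` this can only be a pair in increasing order that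
  -- has not been traded yet.
  descent-below : w y Fin.< w z × suc k ≤ T z (w y)
  descent-below with before-trans perm balanced y⋖x x⋖z
    where
    y⋖x : y ⟨ suc k ⟩ x
    y⋖x = inj₁ (wx<wy , y<x , s≤s (≤-reflexive yx≡k))
    x⋖z : x ⟨ suc k ⟩ z
    x⋖z = inj₂ (wx<wz , λ { (_ , zx<1+k) → <-irrefl zx≡1+k zx<1+k })
  ... | inj₁ (_ , y<z , _)   = contradiction z<y (<-asym y<z)
  ... | inj₂ (wy<wz , ¬zy) = wy<wz , ≮⇒≥ (λ zy<1+k → ¬zy (z<y , zy<1+k))

  descent-cell : InD w z (w y)
  descent-cell = y , z<y , proj₁ descent-below , refl

  descent-cell-≥ : 2 + k ≤ T z (w y)
  descent-cell-≥ = ≤∧≢⇒< (proj₂ descent-below) λ 1+k≡zy →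
    Finₚ.<⇒≢ wx<wy (proj₂ (injective _ _ _ _ dᶻ descent-cell (trans zx≡1+k 1+k≡zy)))

  -- Just before the entry k the three values stand as x y z, consecutively; after k and k + 1
  -- they stand as y z x, so the next value that z passes must be y.
  descent-next : ∀ {u} → z Fin.< u → w u Fin.< w z → T z (w u) ≡ 2 + k → u ≡ y
  descent-next {u} z<u wu<wz zu≡2+k = decidable-stable (u Fin.≟ y) absurd
    where
    du : InD w z (w u)
    du = u , z<u , wu<wz , refl

    u≢x : u ≢ x
    u≢x refl = 1+n≢n (trans (sym zu≡2+k) zx≡1+k)

    absurd : ¬ (u ≢ y)
    absurd u≢y = before-asym w T x⋖z z⋖x
      where
      y⋖z : y ⟨ 3 + k ⟩ z
      y⋖z = inj₂ (proj₁ descent-below , λ { (_ , s≤s zy≤2+k) → u≢y (perm (proj₂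
              (injective _ _ _ _ du descent-cell (trans zu≡2+k (≤-antisym descent-cell-≥ zy≤2+k))))) })
      z⋖u : z ⟨ 3 + k ⟩ u
      z⋖u = inj₁ (wu<wz , z<u , s≤s (≤-reflexive zu≡2+k))
      -- Carried back from time `3 + k`: the entries `2 + k`, `suc k` and `k` sit in the cells
      -- `(z , w u)`, `(z , w x)` and `(y , w x)`, so none of them trades `w y` with `w u`.
      y⋖u : y ⟨ k ⟩ u
      y⋖u =
        before-suc⁻ w T (λ d yu≡ → u≢x (perm (proj₂ (injective _ _ _ _ d dʸ (trans yu≡ (sym yx≡k))))))
        (before-suc⁻ w T (λ d yu≡ → u≢x (perm (proj₂ (injective _ _ _ _ d dᶻ (trans yu≡ (sym zx≡1+k))))))
        (before-suc⁻ w T (λ d yu≡ → Finₚ.<⇒≢ z<y (proj₁ (injective _ _ _ _ du d (trans zu≡2+k (sym yu≡)))))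
        (before-trans perm balanced y⋖z z⋖u)))
      x⋖y : x ⟨ k ⟩ y
      x⋖y = inj₂ (wx<wy , λ { (_ , yx<k) → <-irrefl yx≡k yx<k })
      x⋖u : x ⟨ 2 + k ⟩ u
      x⋖u =
        before-suc⁺ w T (λ d ux≡ → Finₚ.<⇒≢ z<u (proj₁ (injective _ _ _ _ dᶻ d (trans zx≡1+k (sym ux≡)))))
        (before-suc⁺ w T (λ d ux≡ → u≢y (proj₁ (injective _ _ _ _ d dʸ (trans ux≡ (sym yx≡k)))))
        (before-trans perm balanced x⋖y y⋖u))
      u⋖z : u ⟨ 2 + k ⟩ z
      u⋖z = inj₂ (wu<wz , λ { (_ , zu<2+k) → <-irrefl zu≡2+k zu<2+k })
      x⋖z : x ⟨ 2 + k ⟩ z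
      x⋖z = before-trans perm balanced x⋖u u⋖z
      z⋖x : z ⟨ 2 + k ⟩ x
      z⋖x = inj₁ (wx<wz , z<x , s≤s (≤-reflexive zx≡1+k))

-- Exchanging two entries

-- The action of `swapEntries` on one entry, with the same body, so that `swapEntries a b T i c` and
-- `swap a b (T i c)` agree definitionally.
swap : ℕ → ℕ → ℕ → ℕ
swap a b v = if does (v ≟ a) then b else (if does (v ≟ b) then a else v)

swap-left : ∀ {a b v} → v ≡ a → swap a b v ≡ b
swap-left {a} {b} {v} v≡a =
  cong (λ d → if d then b else (if does (v ≟ b) then a else v)) (dec-true (v ≟ a) v≡a)

swap-≢left : ∀ {a b v} → v ≢ a → swap a b v ≡ (if does (v ≟ b) then a else v)
swap-≢left {a} {b} {v} v≢a =
  cong (λ d → if d then b else (if does (v ≟ b) then a else v)) (dec-false (v ≟ a) v≢a)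

swap-right : ∀ {a b v} → v ≡ b → swap a b v ≡ a
swap-right {a} {b} {v} v≡b with v ≟ a
... | yes v≡a = trans (swap-left v≡a) (trans (sym v≡b) v≡a)
... | no v≢a  =
  trans (swap-≢left v≢a) (cong (λ d → if d then a else v) (dec-true (v ≟ b) v≡b))

swap-other : ∀ {a b v} → v ≢ a → v ≢ b → swap a b v ≡ v
swap-other {a} {b} {v} v≢a v≢b =
  trans (swap-≢left v≢a) (cong (λ d → if d then a else v) (dec-false (v ≟ b) v≢b))

data SwapView (a b v : ℕ) : Set where
  left  : v ≡ a → swap a b v ≡ b → SwapView a b v
  right : v ≡ b → swap a b v ≡ a → SwapView a b v
  other : v ≢ a → v ≢ b → swap a b v ≡ v → SwapView a b v

swapView : ∀ a b v → SwapView a b v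
swapView a b v with v ≟ a | v ≟ b
... | yes v≡a | _       = left v≡a (swap-left v≡a)
... | no _    | yes v≡b = right v≡b (swap-right v≡b)
... | no v≢a  | no v≢b  = other v≢a v≢b (swap-other v≢a v≢b)

swap-involutive : ∀ a b v → swap a b (swap a b v) ≡ v
swap-involutive a b v with swapView a b v
... | left v≡a eq      = trans (swap-right eq) (sym v≡a)
... | right v≡b eq     = trans (swap-left eq) (sym v≡b)
... | other v≢a v≢b eq = trans (cong (swap a b) eq) eq

swap-injective : ∀ a b {u v} → swap a b u ≡ swap a b v → u ≡ v
swap-injective a b {u} {v} eq =
  trans (sym (swap-involutive a b u)) (trans (cong (swap a b) eq) (swap-involutive a b v))

Within : ℕ → ℕ → ℕ → Set
Within a b v = a ≤ v × v ≤ b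

Within? : ∀ a b v → Dec (Within a b v)
Within? a b v = a ≤? v ×-dec v ≤? b

within-suc : ∀ {a v} → Within a (suc a) v → v ≡ a ⊎ v ≡ suc a
within-suc (a≤v , v≤1+a) with m≤n⇒m<n∨m≡n a≤v
... | inj₁ a<v = inj₂ (≤-antisym v≤1+a a<v)
... | inj₂ a≡v = inj₁ (sym a≡v)

within-suc² : ∀ {a v} → Within a (2 + a) v → v ≡ a ⊎ v ≡ suc a ⊎ v ≡ 2 + a
within-suc² (a≤v , v≤2+a) with m≤n⇒m<n∨m≡n a≤v
... | inj₁ a<v = inj₂ (within-suc (a<v , v≤2+a))
... | inj₂ a≡v = inj₁ (sym a≡v)

swap-within : ∀ {a b l h v} → Within l h a → Within l h b → Within l h v → Within l h (swap a b v)
swap-within {a} {b} {l} {h} {v} a∈ b∈ v∈ with swapView a b v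
... | left _ eq    = subst (Within l h) (sym eq) b∈
... | right _ eq   = subst (Within l h) (sym eq) a∈
... | other _ _ eq = subst (Within l h) (sym eq) v∈

module _ {a b : ℕ} (a<b : a < b) where

  swap-mono-< : ∀ {u v} → ¬ (Within a b u × Within a b v) → u < v → swap a b u < swap a b v
  swap-mono-< {u} {v} ¬within u<v with swapView a b u | swapView a b v
  ... | left refl eq | left refl _     = contradiction u<v (<-irrefl refl)
  ... | left refl eq | right refl _    =
        contradiction ((≤-refl , <⇒≤ a<b) , (<⇒≤ a<b , ≤-refl)) ¬within
  ... | left refl eq | other _ _ eq′   = subst₂ _<_ (sym eq) (sym eq′)
        (≰⇒> λ v≤b → ¬within ((≤-refl , <⇒≤ a<b) , (<⇒≤ u<v , v≤b)))
  ... | right refl eq | left refl _    = contradiction u<v (<-asym a<b)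
  ... | right refl eq | right refl _   = contradiction u<v (<-irrefl refl)
  ... | right refl eq | other _ _ eq′  = subst₂ _<_ (sym eq) (sym eq′) (<-trans a<b u<v)
  ... | other _ _ eq | left refl eq′   = subst₂ _<_ (sym eq) (sym eq′) (<-trans u<v a<b)
  ... | other _ _ eq | right refl eq′  = subst₂ _<_ (sym eq) (sym eq′)
        (≰⇒> λ a≤u → ¬within ((a≤u , <⇒≤ u<v) , (<⇒≤ a<b , ≤-refl)))
  ... | other _ _ eq | other _ _ eq′   = subst₂ _<_ (sym eq) (sym eq′) u<v

  swap-mono-<⁻ : ∀ {u v} → ¬ (Within a b u × Within a b v) → swap a b u < swap a b v → u < v
  swap-mono-<⁻ {u} {v} ¬within lt =
    subst₂ _<_ (swap-involutive a b u) (swap-involutive a b v)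
      (swap-mono-< (λ { (u∈ , v∈) → ¬within (back u∈ , back v∈) }) lt)
    where
    back : ∀ {v} → Within a b (swap a b v) → Within a b v
    back {v} v∈ = subst (Within a b) (swap-involutive a b v)
      (swap-within (≤-refl , <⇒≤ a<b) (<⇒≤ a<b , ≤-refl) v∈)

-- Inversions under an exchange of two entries

InvPair : {n : ℕ} (w : Fin n → Fin n) (T : Filling n) → (Fin n × Fin n) × (Fin n × Fin n) → Set
InvPair w T ((i , c) , (i′ , c′)) =
  InD w i c × InD w i′ c′ × T i c < T i′ c′ × i′ Fin.< i × ¬ (c ≡ c′)

InvPair? : {n : ℕ} (w : Fin n → Fin n) (T : Filling n) → ∀ pq → Dec (InvPair w T pq)
InvPair? w T ((i , c) , (i′ , c′)) =
  InD? w i c ×-dec InD? w i′ c′ ×-dec T i c <? T i′ c′ ×-dec i′ Fin.<? i ×-dec ¬? (c Fin.≟ c′)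

pairs²-enum : ∀ n → IsEnumeration (cartesianProduct (pairs n) (pairs n))
pairs²-enum n = ×-enum (pairs-enum n) (pairs-enum n)

inv-cong : {n : ℕ} (w : Fin n → Fin n) {S T : Filling n} → S ≈[ w ] T → inv w S ≡ inv w T
inv-cong {n} w {S} {T} S≈T =
  count-cong (InvPair? w S) (InvPair? w T) (pairs²-enum n)
    (λ { (d , d′ , lt , rest) → d , d′ , subst₂ _<_ (S≈T _ _ d) (S≈T _ _ d′) lt , rest })
    (λ { (d , d′ , lt , rest) →
         d , d′ , subst₂ _<_ (sym (S≈T _ _ d)) (sym (S≈T _ _ d′)) lt , rest })

module _ {n : ℕ} {w : Fin n → Fin n} {T : Filling n} (injective : InjectiveOn w T) where

  swapEntries-injective : ∀ a b → InjectiveOn w (swapEntries a b T)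
  swapEntries-injective a b i c i′ c′ d d′ eq = injective i c i′ c′ d d′ (swap-injective a b eq)

  -- Exchanging a and b can only affect the relative order of cells with entries in [a, b]; the
  -- hypothesis leaves the pair {a, b} itself as the only one that inv sees.
  OnlyExtremes : ℕ → ℕ → Set
  OnlyExtremes a b = ∀ {i c i′ c′} → InD w i c → InD w i′ c′ → i ≢ i′ → c ≢ c′ →
    Within a b (T i c) → Within a b (T i′ c′) →
    (T i c ≡ a × T i′ c′ ≡ b) ⊎ (T i c ≡ b × T i′ c′ ≡ a)

  module _ {a b : ℕ} (a<b : a < b) (extremes : OnlyExtremes a b) where

    private
      within-of : ∀ {u v} → ¬ ¬ (Within a b u × Within a b v) → Within a b u × Within a b v
      within-of {u} {v} = decidable-stable (Within? a b u ×-dec Within? a b v)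

    -- An inversion is lost only if the comparison of its entries changes, so both lie in `[a, b]`.
    -- By `extremes` they are `a` and `b`, and their order in `T` decides which is which.
    lost-inversion : ∀ {i c i′ c′} → InvPair w T ((i , c) , (i′ , c′)) →
      ¬ InvPair w (swapEntries a b T) ((i , c) , (i′ , c′)) → T i c ≡ a × T i′ c′ ≡ b
    lost-inversion (d , d′ , lt , i′<i , c≢c′) ¬inv′
      with within-of (λ ¬within → ¬inv′ (d , d′ , swap-mono-< a<b ¬within lt , i′<i , c≢c′))
    ... | u∈ , v∈ with extremes d d′ (λ { refl → <-irrefl refl i′<i }) c≢c′ u∈ v∈
    ... | inj₁ ab           = ab
    ... | inj₂ (u≡b , v≡a) = contradiction (subst₂ _<_ u≡b v≡a lt) (<-asym a<b)

    gained-inversion : ∀ {i c i′ c′} → InvPair w (swapEntries a b T) ((i , c) , (i′ , c′)) →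
      ¬ InvPair w T ((i , c) , (i′ , c′)) → T i c ≡ b × T i′ c′ ≡ a
    gained-inversion (d , d′ , lt , i′<i , c≢c′) ¬inv
      with within-of (λ ¬within → ¬inv (d , d′ , swap-mono-<⁻ a<b ¬within lt , i′<i , c≢c′))
    ... | u∈ , v∈ with extremes d d′ (λ { refl → <-irrefl refl i′<i }) c≢c′ u∈ v∈
    ... | inj₁ (u≡a , v≡b) = contradiction (d , d′ , subst₂ _<_ (sym u≡a) (sym v≡b) a<b , i′<i , c≢c′) ¬inv
    ... | inj₂ ba           = ba

    same-cells : ∀ {u v i₁ c₁ i₁′ c₁′ i₂ c₂ i₂′ c₂′} →
      InD w i₁ c₁ → InD w i₁′ c₁′ → InD w i₂ c₂ → InD w i₂′ c₂′ →
      T i₁ c₁ ≡ u × T i₁′ c₁′ ≡ v → T i₂ c₂ ≡ u × T i₂′ c₂′ ≡ v →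
      ((i₁ , c₁) , (i₁′ , c₁′)) ≡ ((i₂ , c₂) , (i₂′ , c₂′))
    same-cells d₁ d₁′ d₂ d₂′ (u₁ , v₁) (u₂ , v₂)
      with injective _ _ _ _ d₁ d₂ (trans u₁ (sym u₂)) | injective _ _ _ _ d₁′ d₂′ (trans v₁ (sym v₂))
    ... | refl , refl | refl , refl = refl

    inv-swap-≤ : inv w (swapEntries a b T) ≤ suc (inv w T)
    inv-swap-≤ =
      count-⊆-but-one (InvPair? w (swapEntries a b T)) (InvPair? w T) (pairs²-enum n)
        λ p@(d₁ , d₁′ , _) ¬p q@(d₂ , d₂′ , _) ¬q →
          same-cells d₁ d₁′ d₂ d₂′ (gained-inversion p ¬p) (gained-inversion q ¬q)

    -- When `a` lies in the higher row no inversion can be gained, since a new one would need `b`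
    -- above `a`. The inversions thus only shrink, and only by the pair of `a` and `b`.
    inv-swap-suc : ∀ {i c i′ c′} → InD w i c → InD w i′ c′ → i′ Fin.< i → c ≢ c′ →
                   T i c ≡ a → T i′ c′ ≡ b → suc (inv w (swapEntries a b T)) ≡ inv w T
    inv-swap-suc {i} {c} {i′} {c′} d d′ i′<i c≢c′ ≡a ≡b =
      count-suc (InvPair? w (swapEntries a b T)) (InvPair? w T) (pairs²-enum n)
        sub
        (λ p@(d₁ , d₁′ , _) ¬p q@(d₂ , d₂′ , _) ¬q →
          same-cells d₁ d₁′ d₂ d₂′ (lost-inversion p ¬p) (lost-inversion q ¬q))
        {y = (i , c) , (i′ , c′)}
        (d , d′ , subst₂ _<_ (sym ≡a) (sym ≡b) a<b , i′<i , c≢c′)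
        (λ { (_ , _ , lt , _) →
             <-asym a<b (subst₂ _<_ (swap-left ≡a) (swap-right ≡b) lt) })
      where
      sub : ∀ {pq} → InvPair w (swapEntries a b T) pq → InvPair w T pq
      sub {pq} p@(d₁ , d₁′ , _ , i₁′<i₁ , _) =
        decidable-stable (InvPair? w T pq) (λ ¬p → absurd (gained-inversion p ¬p))
        where
        absurd : T (proj₁ (proj₁ pq)) (proj₂ (proj₁ pq)) ≡ b ×
                 T (proj₁ (proj₂ pq)) (proj₂ (proj₂ pq)) ≡ a → ⊥
        absurd (≡b′ , ≡a′)
          with injective _ _ _ _ d₁ d′ (trans ≡b′ (sym ≡b)) | injective _ _ _ _ d₁′ d (trans ≡a′ (sym ≡a))
        ... | refl , refl | refl , refl = <-asym i′<i i₁′<i₁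

-- Coxeter moves

module _ {n : ℕ} (w : Fin n → Fin n) (T : Filling n) where

  𝔠-swaps : ∀ {k} → ¬ SameRow w T k (suc k) → ¬ SameCol w T k (suc k) →
            applyMove w (𝔠 k) T ≡ swapEntries k (suc k) T
  𝔠-swaps {k} ¬row ¬col =
    cong (λ d → if d then T else swapEntries k (suc k) T)
      (dec-false (SameRow? w T k (suc k) ⊎-dec SameCol? w T k (suc k)) [ ¬row , ¬col ]′)

  𝔟-swaps : ∀ {k} → (AboveOf w T k (suc k) × RightOf w T (2 + k) (suc k))
                   ⊎ (AboveOf w T (2 + k) (suc k) × RightOf w T k (suc k)) →
            applyMove w (𝔟 (suc k)) T ≡ swapEntries k (2 + k) T
  𝔟-swaps {k} hook =
    cong (λ d → if d then swapEntries k (2 + k) T else T)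
      (dec-true ((AboveOf? w T k (suc k) ×-dec RightOf? w T (2 + k) (suc k)) ⊎-dec
                 (AboveOf? w T (2 + k) (suc k) ×-dec RightOf? w T k (suc k))) hook)

module _ {n : ℕ} (w : Fin n → Fin n) {S T : Filling n} (S≈T : S ≈[ w ] T) where

  sameRow-resp : ∀ {u v} → SameRow w S u v → SameRow w T u v
  sameRow-resp (i , c , c′ , d , d′ , eq , eq′) =
    i , c , c′ , d , d′ , trans (sym (S≈T _ _ d)) eq , trans (sym (S≈T _ _ d′)) eq′

  sameCol-resp : ∀ {u v} → SameCol w S u v → SameCol w T u v
  sameCol-resp (c , i , i′ , d , d′ , eq , eq′) =
    c , i , i′ , d , d′ , trans (sym (S≈T _ _ d)) eq , trans (sym (S≈T _ _ d′)) eq′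

  aboveOf-resp : ∀ {u v} → AboveOf w S u v → AboveOf w T u v
  aboveOf-resp (c , i , i′ , d , d′ , lt , eq , eq′) =
    c , i , i′ , d , d′ , lt , trans (sym (S≈T _ _ d)) eq , trans (sym (S≈T _ _ d′)) eq′

  rightOf-resp : ∀ {u v} → RightOf w S u v → RightOf w T u v
  rightOf-resp (i , c , c′ , d , d′ , lt , eq , eq′) =
    i , c , c′ , d , d′ , lt , trans (sym (S≈T _ _ d)) eq , trans (sym (S≈T _ _ d′)) eq′

  swapEntries-cong : ∀ a b → swapEntries a b S ≈[ w ] swapEntries a b T
  swapEntries-cong a b i c d = cong (swap a b) (S≈T i c d)

if-cong : {n : ℕ} (w : Fin n → Fin n) {d e : Bool} {S S′ T T′ : Filling n} → d ≡ e →
          S ≈[ w ] S′ → T ≈[ w ] T′ → (if d then S else T) ≈[ w ] (if e then S′ else T′)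
if-cong w {true}  refl S≈S′ T≈T′ = S≈S′
if-cong w {false} refl S≈S′ T≈T′ = T≈T′

if-elim : {A P : Set} (Q : A → Set) (d : Dec P) {x y : A} →
          (P → Q x) → (¬ P → Q y) → Q (if does d then x else y)
if-elim Q (yes p) Qx Qy = Qx p
if-elim Q (no ¬p) Qx Qy = Qy ¬p

≈-sym : {n : ℕ} {w : Fin n → Fin n} {S T : Filling n} → S ≈[ w ] T → T ≈[ w ] S
≈-sym S≈T i c d = sym (S≈T i c d)

applyMove-cong : {n : ℕ} (w : Fin n → Fin n) (m : Move) {S T : Filling n} →
                 S ≈[ w ] T → applyMove w m S ≈[ w ] applyMove w m T
applyMove-cong w (𝔠 k) {S} {T} S≈T =
  if-cong w
    (does-⇔ (mk⇔ (Sum.map (sameRow-resp w S≈T) (sameCol-resp w S≈T))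
                 (Sum.map (sameRow-resp w (≈-sym S≈T)) (sameCol-resp w (≈-sym S≈T))))
      (SameRow? w S k (suc k) ⊎-dec SameCol? w S k (suc k))
      (SameRow? w T k (suc k) ⊎-dec SameCol? w T k (suc k)))
    S≈T (swapEntries-cong w S≈T k (suc k))
applyMove-cong w (𝔟 k) {S} {T} S≈T =
  if-cong w
    (does-⇔ (mk⇔ (hook S≈T) (hook (≈-sym S≈T)))
      ((AboveOf? w S (k ∸ 1) k ×-dec RightOf? w S (suc k) k) ⊎-dec
       (AboveOf? w S (suc k) k ×-dec RightOf? w S (k ∸ 1) k))
      ((AboveOf? w T (k ∸ 1) k ×-dec RightOf? w T (suc k) k) ⊎-dec
       (AboveOf? w T (suc k) k ×-dec RightOf? w T (k ∸ 1) k)))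
    (swapEntries-cong w S≈T (k ∸ 1) (suc k)) S≈T
  where
  hook : ∀ {S T} → S ≈[ w ] T →
         (AboveOf w S (k ∸ 1) k × RightOf w S (suc k) k) ⊎ (AboveOf w S (suc k) k × RightOf w S (k ∸ 1) k) →
         (AboveOf w T (k ∸ 1) k × RightOf w T (suc k) k) ⊎ (AboveOf w T (suc k) k × RightOf w T (k ∸ 1) k)
  hook S≈T = Sum.map (Prod.map (aboveOf-resp w S≈T) (rightOf-resp w S≈T))
                     (Prod.map (aboveOf-resp w S≈T) (rightOf-resp w S≈T))

module _ {n : ℕ} {w : Fin n → Fin n} {T : Filling n} (injective : InjectiveOn w T) where

  adjacent-extremes : ∀ k → OnlyExtremes injective k (suc k)
  adjacent-extremes k d d′ i≢i′ c≢c′ u∈ v∈ with within-suc u∈ | within-suc v∈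
  ... | inj₁ u≡ | inj₁ v≡ = contradiction (proj₁ (injective _ _ _ _ d d′ (trans u≡ (sym v≡)))) i≢i′
  ... | inj₁ u≡ | inj₂ v≡ = inj₁ (u≡ , v≡)
  ... | inj₂ u≡ | inj₁ v≡ = inj₂ (u≡ , v≡)
  ... | inj₂ u≡ | inj₂ v≡ = contradiction (proj₁ (injective _ _ _ _ d d′ (trans u≡ (sym v≡)))) i≢i′

  Collinear : ℕ → ℕ → Set
  Collinear u v = ∀ {i c i′ c′} → InD w i c → InD w i′ c′ → T i c ≡ u → T i′ c′ ≡ v → i ≡ i′ ⊎ c ≡ c′

  aboveOf⇒collinear : ∀ {u v} → AboveOf w T u v → Collinear u v
  aboveOf⇒collinear (_ , _ , _ , d₀ , d₀′ , _ , ≡v₀ , ≡u₀) d d′ ≡u ≡v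
    with injective _ _ _ _ d d₀′ (trans ≡u (sym ≡u₀)) | injective _ _ _ _ d′ d₀ (trans ≡v (sym ≡v₀))
  ... | refl , refl | refl , refl = inj₂ refl

  rightOf⇒collinear : ∀ {u v} → RightOf w T u v → Collinear u v
  rightOf⇒collinear (_ , _ , _ , d₀ , d₀′ , _ , ≡v₀ , ≡u₀) d d′ ≡u ≡v
    with injective _ _ _ _ d d₀′ (trans ≡u (sym ≡u₀)) | injective _ _ _ _ d′ d₀ (trans ≡v (sym ≡v₀))
  ... | refl , refl | refl , refl = inj₁ refl

  -- The middle entry `suc k` shares a row or a column with each end, so a pair in different rows
  -- and columns cannot contain it; by injectivity the pair cannot repeat an entry either.
  hook-extremes : ∀ {k} → Collinear k (suc k) → Collinear (2 + k) (suc k) →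
                  OnlyExtremes injective k (2 + k)
  hook-extremes low high {i} {c} {i′} {c′} d d′ i≢i′ c≢c′ u∈ v∈ with within-suc² u∈ | within-suc² v∈
  ... | inj₁ u≡        | inj₂ (inj₂ v≡) = inj₁ (u≡ , v≡)
  ... | inj₂ (inj₂ u≡) | inj₁ v≡        = inj₂ (u≡ , v≡)
  ... | inj₁ u≡        | inj₂ (inj₁ v≡) = ⊥-elim ([ i≢i′ , c≢c′ ]′ (low d d′ u≡ v≡))
  ... | inj₂ (inj₂ u≡) | inj₂ (inj₁ v≡) = ⊥-elim ([ i≢i′ , c≢c′ ]′ (high d d′ u≡ v≡))
  ... | inj₂ (inj₁ u≡) | inj₁ v≡        = ⊥-elim ([ i≢i′ ∘ sym , c≢c′ ∘ sym ]′ (low d′ d v≡ u≡))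
  ... | inj₂ (inj₁ u≡) | inj₂ (inj₂ v≡) = ⊥-elim ([ i≢i′ ∘ sym , c≢c′ ∘ sym ]′ (high d′ d v≡ u≡))
  ... | inj₁ u≡        | inj₁ v≡        = contradiction (proj₁ (injective _ _ _ _ d d′ (trans u≡ (sym v≡)))) i≢i′
  ... | inj₂ (inj₁ u≡) | inj₂ (inj₁ v≡) = contradiction (proj₁ (injective _ _ _ _ d d′ (trans u≡ (sym v≡)))) i≢i′
  ... | inj₂ (inj₂ u≡) | inj₂ (inj₂ v≡) = contradiction (proj₁ (injective _ _ _ _ d d′ (trans u≡ (sym v≡)))) i≢i′

  move-injective×inv : ∀ m → ValidMove w m →
    InjectiveOn w (applyMove w m T) × inv w (applyMove w m T) ≤ suc (inv w T)
  move-injective×inv (𝔠 k) _ =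
    if-elim Tame (SameRow? w T k (suc k) ⊎-dec SameCol? w T k (suc k))
      (λ _ → injective , n≤1+n _)
      (λ _ → swapEntries-injective injective k (suc k) ,
             inv-swap-≤ injective ≤-refl (adjacent-extremes k))
    where Tame = λ S → InjectiveOn w S × inv w S ≤ suc (inv w T)
  -- Validity excludes `𝔟 0`; writing the centre as `suc k` turns the exchanged entries into `k` and
  -- `2 + k`.
  move-injective×inv (𝔟 (suc k)) _ =
    if-elim Tame ((AboveOf? w T k (suc k) ×-dec RightOf? w T (2 + k) (suc k)) ⊎-dec
                  (AboveOf? w T (2 + k) (suc k) ×-dec RightOf? w T k (suc k)))
      (λ hook → swapEntries-injective injective k (2 + k) ,
                inv-swap-≤ injective (n≤1+n _) ([ one-way , other-way ]′ hook))
      (λ _ → injective , n≤1+n _)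
    where
    Tame = λ S → InjectiveOn w S × inv w S ≤ suc (inv w T)
    one-way : AboveOf w T k (suc k) × RightOf w T (2 + k) (suc k) → OnlyExtremes injective k (2 + k)
    one-way (above , rightOf) = hook-extremes (aboveOf⇒collinear above) (rightOf⇒collinear rightOf)
    other-way : AboveOf w T (2 + k) (suc k) × RightOf w T k (suc k) → OnlyExtremes injective k (2 + k)
    other-way (above , rightOf) = hook-extremes (rightOf⇒collinear rightOf) (aboveOf⇒collinear above)

-- The lower bound along a sequence of moves

inv-applyMoves-≤ : {n : ℕ} (w : Fin n → Fin n) (gs : List Move) → All (ValidMove w) gs →
                   (T : Filling n) → InjectiveOn w T →
                   inv w (applyMoves w gs T) ≤ length gs + inv w T
inv-applyMoves-≤ w [] [] T injective = ≤-refl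
inv-applyMoves-≤ w (g ∷ gs) (valid ∷ valids) T injective with move-injective×inv injective g valid
... | injective′ , inv≤ =
  ≤-trans (inv-applyMoves-≤ w gs valids (applyMove w g T) injective′)
    (subst (length gs + inv w (applyMove w g T) ≤_) (+-suc (length gs) (inv w T))
      (+-monoʳ-≤ (length gs) inv≤))

-- The super-Yamanouchi tableau

ReadBefore : {n : ℕ} → Fin n → Fin n → Fin n → Fin n → Set
ReadBefore i c i′ c′ = i Fin.< i′ ⊎ (i ≡ i′ × c′ Fin.< c)

readBefore-cmp : {n : ℕ} (i c i′ c′ : Fin n) →
                 ReadBefore i c i′ c′ ⊎ (i ≡ i′ × c ≡ c′) ⊎ ReadBefore i′ c′ i c
readBefore-cmp i c i′ c′ with Finₚ.<-cmp i i′ | Finₚ.<-cmp c c′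
... | tri< i<i′ _ _ | _             = inj₁ (inj₁ i<i′)
... | tri> _ _ i′<i | _             = inj₂ (inj₂ (inj₁ i′<i))
... | tri≈ _ refl _ | tri> _ _ c′<c = inj₁ (inj₂ (refl , c′<c))
... | tri≈ _ refl _ | tri≈ _ refl _ = inj₂ (inj₁ (refl , refl))
... | tri≈ _ refl _ | tri< c<c′ _ _ = inj₂ (inj₂ (inj₂ (refl , c<c′)))

module _ {n : ℕ} (w : Fin n → Fin n) where

  ReadUpTo : Fin n → Fin n → Fin n × Fin n → Set
  ReadUpTo i c (i′ , c′) = InD w i′ c′ × (i′ Fin.< i ⊎ (i′ ≡ i × c Fin.≤ c′))

  ReadUpTo? : ∀ i c p → Dec (ReadUpTo i c p)
  ReadUpTo? i c (i′ , c′) = InD? w i′ c′ ×-dec (i′ Fin.<? i ⊎-dec (i′ Fin.≟ i ×-dec c Fin.≤? c′))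

  superYamanouchi-mono : ∀ {i c i′ c′} → InD w i′ c′ → ReadBefore i c i′ c′ →
                         superYamanouchi w i c < superYamanouchi w i′ c′
  superYamanouchi-mono {i} {c} {i′} {c′} d′ before =
    count-⊂ (ReadUpTo? i c) (ReadUpTo? i′ c′) (pairs-enum n) (λ { (d , upTo) → d , extend before upTo })
      {y = i′ , c′} (d′ , inj₂ (refl , ≤-refl)) (λ { (_ , upTo) → last before upTo })
    where
    extend : ∀ {j e} → ReadBefore i c i′ c′ → j Fin.< i ⊎ (j ≡ i × c Fin.≤ e) →
             j Fin.< i′ ⊎ (j ≡ i′ × c′ Fin.≤ e)
    extend (inj₁ i<i′)          (inj₁ j<i)          = inj₁ (<-trans j<i i<i′)
    extend (inj₁ i<i′)          (inj₂ (refl , _))   = inj₁ i<i′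
    extend (inj₂ (refl , _))    (inj₁ j<i)          = inj₁ j<i
    extend (inj₂ (refl , c′<c)) (inj₂ (refl , c≤e)) = inj₂ (refl , <⇒≤ (≤-trans c′<c c≤e))
    last : ReadBefore i c i′ c′ → ¬ (i′ Fin.< i ⊎ (i′ ≡ i × c Fin.≤ c′))
    last (inj₁ i<i′)          (inj₁ i′<i)          = <-asym i<i′ i′<i
    last (inj₁ i<i′)          (inj₂ (refl , _))    = <-irrefl refl i<i′
    last (inj₂ (refl , _))    (inj₁ i′<i)          = <-irrefl refl i′<i
    last (inj₂ (refl , c′<c)) (inj₂ (refl , c≤c′)) = ≤⇒≯ c≤c′ c′<c

  superYamanouchi-injective : InjectiveOn w (superYamanouchi w)
  superYamanouchi-injective i c i′ c′ d d′ eq with readBefore-cmp i c i′ c′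
  ... | inj₁ before        = contradiction (superYamanouchi-mono d′ before) (<-irrefl eq)
  ... | inj₂ (inj₁ same)   = same
  ... | inj₂ (inj₂ before) = contradiction (superYamanouchi-mono d before) (<-irrefl (sym eq))

  inv-superYamanouchi : inv w (superYamanouchi w) ≡ 0
  inv-superYamanouchi =
    count-none (InvPair? w (superYamanouchi w)) (cartesianProduct (pairs n) (pairs n))
      λ { (d , _ , lt , i′<i , _) → <-asym lt (superYamanouchi-mono d (inj₁ i′<i)) }

  module _ {R : Filling n} (sbt : IsSBT w R)
           (sorted : ∀ {i c i′ c′} → InD w i c → InD w i′ c′ → ReadBefore i c i′ c′ → R i c < R i′ c′) where

    open IsSBT sbt

    -- `R` itself matches the cells read up to `(i , c)` with the values from `1` to `R i c`:
    -- sortedness makes them exactly the cells with entry at most `R i c`, and surjectivity supplies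
    -- a cell for every value. Each inequality is one direction of this matching; `v : Fin (R i c)`
    -- stands for the value `suc (toℕ v)`.
    sorted⇒superYamanouchi : superYamanouchi w ≈[ w ] R
    sorted⇒superYamanouchi i c d = ≤-antisym
      (subst (superYamanouchi w i c ≤_) (length-tabulate id)
        (length-≤ (λ { (j , e) v → InD w j e × R j e ≡ suc (toℕ v) }) unique
          (Unique.filter⁺ (ReadUpTo? i c) (proj₁ (pairs-enum n))) entry))
      (subst (_≤ superYamanouchi w i c) (length-tabulate id)
        (length-≤ (λ { v (j , e) → R j e ≡ suc (toℕ v) })
          (λ eq eq′ → toℕ-injective (suc-injective (trans (sym eq) eq′)))
          (Unique.allFin⁺ (R i c)) cell))
      where
      unique : LeftInjective {B = Fin (R i c)} (λ { (j , e) v → InD w j e × R j e ≡ suc (toℕ v) })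
      unique (d₁ , eq₁) (d₂ , eq₂) with injective _ _ _ _ d₁ d₂ (trans eq₁ (sym eq₂))
      ... | refl , refl = refl

      upTo⇒≤ : ∀ {j e} → InD w j e → j Fin.< i ⊎ (j ≡ i × c Fin.≤ e) → R j e ≤ R i c
      upTo⇒≤ d₁ (inj₁ j<i) = <⇒≤ (sorted d₁ d (inj₁ j<i))
      upTo⇒≤ {j} {e} d₁ (inj₂ (refl , c≤e)) with m≤n⇒m<n∨m≡n c≤e
      ... | inj₁ c<e = <⇒≤ (sorted d₁ d (inj₂ (refl , c<e)))
      ... | inj₂ c≡e = ≤-reflexive (cong (R i) (sym (toℕ-injective c≡e)))

      ≤⇒upTo : ∀ {j e} → InD w j e → R j e ≤ R i c → j Fin.< i ⊎ (j ≡ i × c Fin.≤ e)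
      ≤⇒upTo {j} {e} d₁ ≤ic with readBefore-cmp j e i c
      ... | inj₁ (inj₁ j<i)           = inj₁ j<i
      ... | inj₁ (inj₂ (refl , c<e))  = inj₂ (refl , <⇒≤ c<e)
      ... | inj₂ (inj₁ (refl , refl)) = inj₂ (refl , ≤-refl)
      ... | inj₂ (inj₂ before)        = contradiction (sorted d d₁ before) (≤⇒≯ ≤ic)

      entry : ∀ {p} → p ∈ filter (ReadUpTo? i c) (pairs n) →
              ∃[ v ] (v ∈ allFin (R i c) × InD w (proj₁ p) (proj₂ p) × R (proj₁ p) (proj₂ p) ≡ suc (toℕ v))
      entry {j , e} p∈ with ∈-filter⁻ (ReadUpTo? i c) {xs = pairs n} p∈
      ... | _ , d₁ , upTo with R j e | proj₁ (inRange j e d₁) | upTo⇒≤ d₁ upTo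
      ... | suc v | _ | v< = Fin.fromℕ< v< , ∈-allFin _ , d₁ , cong suc (sym (Finₚ.toℕ-fromℕ< v<))

      cell : ∀ {v} → v ∈ allFin (R i c) →
             ∃[ p ] (p ∈ filter (ReadUpTo? i c) (pairs n) × R (proj₁ p) (proj₂ p) ≡ suc (toℕ v))
      cell {v} _ with surjective (suc (toℕ v)) (s≤s z≤n) (≤-trans (toℕ<n v) (proj₂ (inRange i c d)))
      ... | j , e , d₁ , eq = (j , e) ,
            ∈-filter⁺ (ReadUpTo? i c) (proj₂ (pairs-enum n) (j , e))
              (d₁ , ≤⇒upTo d₁ (subst (_≤ R i c) (sym eq) (toℕ<n v))) , eq

-- Descending to the super-Yamanouchi tableau

-- `undo` is what allows descents to be read backwards: the move that leads down from `R` is also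
-- the last move of a sequence arriving at `R`.
record Descent {n : ℕ} (w : Fin n → Fin n) (R : Filling n) : Set where
  field
    move    : Move
    valid   : ValidMove w move
    sbt     : IsSBT w (applyMove w move R)
    inv-suc : suc (inv w (applyMove w move R)) ≡ inv w R
    undo    : applyMove w move (applyMove w move R) ≈[ w ] R

module _ {n : ℕ} {w : Fin n → Fin n} {R : Filling n} (sbt : IsSBT w R) where

  open IsSBT sbt

  swapEntries-sbt : ∀ {a b} → Within 1 (ℓ w) a → Within 1 (ℓ w) b →
                    IsBalanced w (swapEntries a b R) → IsSBT w (swapEntries a b R)
  swapEntries-sbt {a} {b} a∈ b∈ balanced′ = record
    { inRange    = λ i c d → swap-within a∈ b∈ (inRange i c d)
    ; injective  = swapEntries-injective injective a b
    ; surjective = surj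
    ; balanced   = balanced′
    }
    where
    surj : ∀ k → 1 ≤ k → k ≤ ℓ w → ∃[ i ] ∃[ c ] (InD w i c × swapEntries a b R i c ≡ k)
    surj k 1≤k k≤ℓ with swap-within a∈ b∈ (1≤k , k≤ℓ)
    ... | 1≤k′ , k′≤ℓ with surjective (swap a b k) 1≤k′ k′≤ℓ
    ... | i , c , d , eq = i , c , d , trans (cong (swap a b) eq) (swap-involutive a b k)

  swap-descent : ∀ m {a b} → ValidMove w m → applyMove w m R ≡ swapEntries a b R →
    applyMove w m (swapEntries a b R) ≡ swapEntries a b (swapEntries a b R) →
    IsSBT w (swapEntries a b R) → suc (inv w (swapEntries a b R)) ≡ inv w R → Descent w R
  swap-descent m {a} {b} valid swaps swaps′ sbt′ inv-suc = record
    { move    = m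
    ; valid   = valid
    ; sbt     = subst (IsSBT w) (sym swaps) sbt′
    ; inv-suc = trans (cong (suc ∘ inv w) swaps) inv-suc
    ; undo    = λ i c _ → trans (cong (λ S → applyMove w m S i c) swaps)
                  (trans (cong (λ S → S i c) swaps′) (swap-involutive a b (R i c)))
    }

  module _ {a b : ℕ} (a<b : a < b) {i c : Fin n} where

    rightLarger-swap : (∀ {c′} → c Fin.< c′ → InD w i c′ → ¬ (Within a b (R i c) × Within a b (R i c′))) →
                       rightLarger w (swapEntries a b R) i c ≡ rightLarger w R i c
    rightLarger-swap apart = count-cong
      (λ c′ → c Fin.<? c′ ×-dec InD? w i c′ ×-dec swapEntries a b R i c <? swapEntries a b R i c′)
      (λ c′ → c Fin.<? c′ ×-dec InD? w i c′ ×-dec R i c <? R i c′)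
      (allFin-enum n)
      (λ { (c<c′ , d , lt) → c<c′ , d , swap-mono-<⁻ a<b (apart c<c′ d) lt })
      (λ { (c<c′ , d , lt) → c<c′ , d , swap-mono-< a<b (apart c<c′ d) lt })

    aboveSmaller-swap : (∀ {i′} → i Fin.< i′ → InD w i′ c → ¬ (Within a b (R i′ c) × Within a b (R i c))) →
                        aboveSmaller w (swapEntries a b R) i c ≡ aboveSmaller w R i c
    aboveSmaller-swap apart = count-cong
      (λ i′ → i Fin.<? i′ ×-dec InD? w i′ c ×-dec swapEntries a b R i′ c <? swapEntries a b R i c)
      (λ i′ → i Fin.<? i′ ×-dec InD? w i′ c ×-dec R i′ c <? R i c)
      (allFin-enum n)
      (λ { (i<i′ , d , lt) → i<i′ , d , swap-mono-<⁻ a<b (apart i<i′ d) lt })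
      (λ { (i<i′ , d , lt) → i<i′ , d , swap-mono-< a<b (apart i<i′ d) lt })

  module _ {k : ℕ} {i c i′ c′ : Fin n} (d : InD w i c) (d′ : InD w i′ c′)
           (≡k : R i c ≡ k) (≡1+k : R i′ c′ ≡ suc k) (i′<i : i′ Fin.< i) (c≢c′ : c ≢ c′) where

    private
      i≢i′ : i ≢ i′
      i≢i′ i≡i′ = Finₚ.<⇒≢ i′<i (sym i≡i′)

      R′ : Filling n
      R′ = swapEntries k (suc k) R

      row-apart : ∀ {r x y} → InD w r x → InD w r y → x ≢ y →
                  ¬ (Within k (suc k) (R r x) × Within k (suc k) (R r y))
      row-apart dx dy x≢y (x∈ , y∈) with within-suc x∈ | within-suc y∈
      ... | inj₁ x≡ | inj₁ y≡ = x≢y (proj₂ (injective _ _ _ _ dx dy (trans x≡ (sym y≡))))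
      ... | inj₂ x≡ | inj₂ y≡ = x≢y (proj₂ (injective _ _ _ _ dx dy (trans x≡ (sym y≡))))
      ... | inj₁ x≡ | inj₂ y≡ = i≢i′ (trans (sym (proj₁ (injective _ _ _ _ dx d (trans x≡ (sym ≡k)))))
                                            (proj₁ (injective _ _ _ _ dy d′ (trans y≡ (sym ≡1+k)))))
      ... | inj₂ x≡ | inj₁ y≡ = i≢i′ (trans (sym (proj₁ (injective _ _ _ _ dy d (trans y≡ (sym ≡k)))))
                                            (proj₁ (injective _ _ _ _ dx d′ (trans x≡ (sym ≡1+k)))))

      col-apart : ∀ {e x y} → InD w x e → InD w y e → x ≢ y →
                  ¬ (Within k (suc k) (R x e) × Within k (suc k) (R y e))
      col-apart dx dy x≢y (x∈ , y∈) with within-suc x∈ | within-suc y∈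
      ... | inj₁ x≡ | inj₁ y≡ = x≢y (proj₁ (injective _ _ _ _ dx dy (trans x≡ (sym y≡))))
      ... | inj₂ x≡ | inj₂ y≡ = x≢y (proj₁ (injective _ _ _ _ dx dy (trans x≡ (sym y≡))))
      ... | inj₁ x≡ | inj₂ y≡ = c≢c′ (trans (sym (proj₂ (injective _ _ _ _ dx d (trans x≡ (sym ≡k)))))
                                            (proj₂ (injective _ _ _ _ dy d′ (trans y≡ (sym ≡1+k)))))
      ... | inj₂ x≡ | inj₁ y≡ = c≢c′ (trans (sym (proj₂ (injective _ _ _ _ dy d (trans y≡ (sym ≡k)))))
                                            (proj₂ (injective _ _ _ _ dx d′ (trans x≡ (sym ≡1+k)))))

      balanced′ : IsBalanced w R′
      balanced′ r e dr = trans (rightLarger-swap ≤-refl (λ e<e′ dr′ → row-apart dr dr′ (Finₚ.<⇒≢ e<e′)))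
        (trans (balanced r e dr)
          (sym (aboveSmaller-swap ≤-refl (λ r<r′ dr′ → col-apart dr′ dr (λ r′≡r → Finₚ.<⇒≢ r<r′ (sym r′≡r))))))

      swaps : ∀ {S} → InjectiveOn w S → ∀ {i c i′ c′} → InD w i c → InD w i′ c′ →
              S i c ≡ k → S i′ c′ ≡ suc k → i ≢ i′ → c ≢ c′ →
              applyMove w (𝔠 k) S ≡ swapEntries k (suc k) S
      swaps {S} inj d d′ ≡k ≡1+k i≢i′ c≢c′ = 𝔠-swaps w S
        (λ { (_ , _ , _ , e , e′ , eq , eq′) →
             i≢i′ (trans (proj₁ (inj _ _ _ _ d e (trans ≡k (sym eq))))
                         (proj₁ (inj _ _ _ _ e′ d′ (trans eq′ (sym ≡1+k))))) })
        (λ { (_ , _ , _ , e , e′ , eq , eq′) →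
             c≢c′ (trans (proj₂ (inj _ _ _ _ d e (trans ≡k (sym eq))))
                         (proj₂ (inj _ _ _ _ e′ d′ (trans eq′ (sym ≡1+k))))) })

    -- No row or column contains both `k` and `suc k`, so every comparison that enters the balance
    -- condition survives the exchange. The two entries are still apart afterwards, hence the same
    -- move undoes it.
    𝔠-descent : Descent w R
    𝔠-descent = swap-descent (𝔠 k) (1≤k , k<ℓ)
      (swaps injective d d′ ≡k ≡1+k i≢i′ c≢c′)
      (swaps (swapEntries-injective injective k (suc k)) d′ d
        (swap-right ≡1+k) (swap-left ≡k) (i≢i′ ∘ sym) (c≢c′ ∘ sym))
      (swapEntries-sbt (1≤k , <⇒≤ k<ℓ) (s≤s z≤n , k<ℓ) balanced′)
      (inv-swap-suc injective ≤-refl (adjacent-extremes injective k) d d′ i′<i c≢c′ ≡k ≡1+k)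
      where
      1≤k : 1 ≤ k
      1≤k = subst (1 ≤_) ≡k (proj₁ (inRange i c d))
      k<ℓ : k < ℓ w
      k<ℓ = subst (_≤ ℓ w) ≡1+k (proj₂ (inRange i′ c′ d′))

  module _ {k : ℕ} {i c i′ c′ : Fin n} (corner : InD w i c) (top : InD w i′ c) (arm : InD w i c′)
           (i<i′ : i Fin.< i′) (c<c′ : c Fin.< c′)
           (≡k : R i′ c ≡ k) (≡1+k : R i c ≡ suc k) (≡2+k : R i c′ ≡ 2 + k) where

    private
      R′ : Filling n
      R′ = swapEntries k (2 + k) R

      k<2+k : k < 2 + k
      k<2+k = n≤1+n _

      at-top : ∀ {r e} → InD w r e → R r e ≡ k → r ≡ i′ × e ≡ c
      at-top d eq = injective _ _ _ _ d top (trans eq (sym ≡k))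

      at-corner : ∀ {r e} → InD w r e → R r e ≡ suc k → r ≡ i × e ≡ c
      at-corner d eq = injective _ _ _ _ d corner (trans eq (sym ≡1+k))

      at-arm : ∀ {r e} → InD w r e → R r e ≡ 2 + k → r ≡ i × e ≡ c′
      at-arm d eq = injective _ _ _ _ d arm (trans eq (sym ≡2+k))

      -- The corner, top and arm are the only cells with entries in [k, 2 + k], and among them
      -- only the corner has another one to its right or above it.
      right-apart : ∀ {r e e′} → InD w r e → InD w r e′ → e Fin.< e′ → ¬ (r ≡ i × e ≡ c) →
                    ¬ (Within k (2 + k) (R r e) × Within k (2 + k) (R r e′))
      right-apart d d′ e<e′ ¬corner (x∈ , y∈) with within-suc² x∈ | within-suc² y∈
      ... | inj₂ (inj₁ x≡) | _ = ¬corner (at-corner d x≡)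
      ... | inj₁ x≡ | inj₁ y≡ =
            Finₚ.<⇒≢ e<e′ (trans (proj₂ (at-top d x≡)) (sym (proj₂ (at-top d′ y≡))))
      ... | inj₁ x≡ | inj₂ (inj₁ y≡) =
            Finₚ.<⇒≢ i<i′ (trans (sym (proj₁ (at-corner d′ y≡))) (proj₁ (at-top d x≡)))
      ... | inj₁ x≡ | inj₂ (inj₂ y≡) =
            Finₚ.<⇒≢ i<i′ (trans (sym (proj₁ (at-arm d′ y≡))) (proj₁ (at-top d x≡)))
      ... | inj₂ (inj₂ x≡) | inj₁ y≡ =
            Finₚ.<⇒≢ i<i′ (trans (sym (proj₁ (at-arm d x≡))) (proj₁ (at-top d′ y≡)))
      ... | inj₂ (inj₂ x≡) | inj₂ (inj₁ y≡) =
            <-asym c<c′ (subst₂ Fin._<_ (proj₂ (at-arm d x≡)) (proj₂ (at-corner d′ y≡)) e<e′)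
      ... | inj₂ (inj₂ x≡) | inj₂ (inj₂ y≡) =
            Finₚ.<⇒≢ e<e′ (trans (proj₂ (at-arm d x≡)) (sym (proj₂ (at-arm d′ y≡))))

      above-apart : ∀ {r r′ e} → InD w r e → InD w r′ e → r Fin.< r′ → ¬ (r ≡ i × e ≡ c) →
                    ¬ (Within k (2 + k) (R r′ e) × Within k (2 + k) (R r e))
      above-apart d d′ r<r′ ¬corner (y∈ , x∈) with within-suc² x∈ | within-suc² y∈
      ... | inj₂ (inj₁ x≡) | _ = ¬corner (at-corner d x≡)
      ... | inj₁ x≡ | inj₁ y≡ =
            Finₚ.<⇒≢ r<r′ (trans (proj₁ (at-top d x≡)) (sym (proj₁ (at-top d′ y≡))))
      ... | inj₁ x≡ | inj₂ (inj₁ y≡) =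
            <-asym i<i′ (subst₂ Fin._<_ (proj₁ (at-top d x≡)) (proj₁ (at-corner d′ y≡)) r<r′)
      ... | inj₁ x≡ | inj₂ (inj₂ y≡) =
            Finₚ.<⇒≢ c<c′ (trans (sym (proj₂ (at-top d x≡))) (proj₂ (at-arm d′ y≡)))
      ... | inj₂ (inj₂ x≡) | inj₁ y≡ =
            Finₚ.<⇒≢ c<c′ (trans (sym (proj₂ (at-top d′ y≡))) (proj₂ (at-arm d x≡)))
      ... | inj₂ (inj₂ x≡) | inj₂ (inj₁ y≡) =
            Finₚ.<⇒≢ c<c′ (trans (sym (proj₂ (at-corner d′ y≡))) (proj₂ (at-arm d x≡)))
      ... | inj₂ (inj₂ x≡) | inj₂ (inj₂ y≡) =
            Finₚ.<⇒≢ r<r′ (trans (proj₁ (at-arm d x≡)) (sym (proj₁ (at-arm d′ y≡))))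

      corner-fixed : R′ i c ≡ suc k
      corner-fixed = trans (swap-other {a = k} {b = 2 + k} (λ eq → 1+n≢n (trans (sym ≡1+k) eq))
                                       (λ eq → 1+n≢n (trans (sym eq) ≡1+k))) ≡1+k

      right-of-corner : ∀ {e} → c Fin.< e → InD w i e →
        ¬ (Within k (2 + k) (R i c) × Within k (2 + k) (R i e)) ⊎ e ≡ c′
      right-of-corner {e} c<e d with Within? k (2 + k) (R i e)
      ... | no ∉ = inj₁ (∉ ∘ proj₂)
      ... | yes ∈ with within-suc² ∈
      ...   | inj₁ eq        = contradiction (proj₁ (at-top d eq)) (Finₚ.<⇒≢ i<i′)
      ...   | inj₂ (inj₁ eq) = contradiction (sym (proj₂ (at-corner d eq))) (Finₚ.<⇒≢ c<e)
      ...   | inj₂ (inj₂ eq) = inj₂ (proj₂ (at-arm d eq))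

      above-corner : ∀ {r} → i Fin.< r → InD w r c →
        ¬ (Within k (2 + k) (R r c) × Within k (2 + k) (R i c)) ⊎ r ≡ i′
      above-corner {r} i<r d with Within? k (2 + k) (R r c)
      ... | no ∉ = inj₁ (∉ ∘ proj₁)
      ... | yes ∈ with within-suc² ∈
      ...   | inj₁ eq        = inj₂ (proj₁ (at-top d eq))
      ...   | inj₂ (inj₁ eq) = contradiction (sym (proj₁ (at-corner d eq))) (Finₚ.<⇒≢ i<r)
      ...   | inj₂ (inj₂ eq) = contradiction (proj₂ (at-arm d eq)) (Finₚ.<⇒≢ c<c′)

      arm-larger : R i c < R i c′
      arm-larger = subst₂ _<_ (sym ≡1+k) (sym ≡2+k) ≤-refl

      arm-smaller′ : ¬ (R′ i c < R′ i c′)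
      arm-smaller′ lt = <-asym (subst₂ _<_ corner-fixed (swap-right ≡2+k) lt) ≤-refl

      top-smaller : R i′ c < R i c
      top-smaller = subst₂ _<_ (sym ≡k) (sym ≡1+k) ≤-refl

      top-larger′ : ¬ (R′ i′ c < R′ i c)
      top-larger′ lt = <-asym (subst₂ _<_ (swap-left ≡k) corner-fixed lt) ≤-refl

      -- The arm falls from `2 + k` to `k`, passing the corner's `suc k`, and leaves the count on
      -- the right. The top rises past the corner in the same way and leaves the count above, so
      -- balance at the corner persists with both sides lowered by one.
      rightLarger-corner : suc (rightLarger w R′ i c) ≡ rightLarger w R i c
      rightLarger-corner = count-suc
        (λ e → c Fin.<? e ×-dec InD? w i e ×-dec R′ i c <? R′ i e)
        (λ e → c Fin.<? e ×-dec InD? w i e ×-dec R i c <? R i e)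
        (allFin-enum n) sub
        (λ p ¬p q ¬q → trans (lost p ¬p) (sym (lost q ¬q)))
        (c<c′ , arm , arm-larger) (λ { (_ , _ , lt) → arm-smaller′ lt })
        where
        sub : ∀ {e} → c Fin.< e × InD w i e × R′ i c < R′ i e → c Fin.< e × InD w i e × R i c < R i e
        sub (c<e , d , lt) with right-of-corner c<e d
        ... | inj₁ apart = c<e , d , swap-mono-<⁻ k<2+k apart lt
        ... | inj₂ refl  = c<e , d , arm-larger
        lost : ∀ {e} → c Fin.< e × InD w i e × R i c < R i e →
               ¬ (c Fin.< e × InD w i e × R′ i c < R′ i e) → e ≡ c′
        lost (c<e , d , lt) ¬lt′ with right-of-corner c<e d
        ... | inj₁ apart = contradiction (c<e , d , swap-mono-< k<2+k apart lt) ¬lt′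
        ... | inj₂ e≡c′  = e≡c′

      aboveSmaller-corner : suc (aboveSmaller w R′ i c) ≡ aboveSmaller w R i c
      aboveSmaller-corner = count-suc
        (λ r → i Fin.<? r ×-dec InD? w r c ×-dec R′ r c <? R′ i c)
        (λ r → i Fin.<? r ×-dec InD? w r c ×-dec R r c <? R i c)
        (allFin-enum n) sub
        (λ p ¬p q ¬q → trans (lost p ¬p) (sym (lost q ¬q)))
        (i<i′ , top , top-smaller) (λ { (_ , _ , lt) → top-larger′ lt })
        where
        sub : ∀ {r} → i Fin.< r × InD w r c × R′ r c < R′ i c → i Fin.< r × InD w r c × R r c < R i c
        sub (i<r , d , lt) with above-corner i<r d
        ... | inj₁ apart = i<r , d , swap-mono-<⁻ k<2+k apart lt
        ... | inj₂ refl  = i<r , d , top-smaller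
        lost : ∀ {r} → i Fin.< r × InD w r c × R r c < R i c →
               ¬ (i Fin.< r × InD w r c × R′ r c < R′ i c) → r ≡ i′
        lost (i<r , d , lt) ¬lt′ with above-corner i<r d
        ... | inj₁ apart = contradiction (i<r , d , swap-mono-< k<2+k apart lt) ¬lt′
        ... | inj₂ r≡i′  = r≡i′

      balanced′ : IsBalanced w R′
      balanced′ r e d with r Fin.≟ i ×-dec e Fin.≟ c
      ... | yes (refl , refl) = suc-injective
            (trans rightLarger-corner (trans (balanced r e d) (sym aboveSmaller-corner)))
      ... | no ¬corner =
            trans (rightLarger-swap k<2+k (λ e<e′ d′ → right-apart d d′ e<e′ ¬corner))
              (trans (balanced r e d)
                (sym (aboveSmaller-swap k<2+k (λ r<r′ d′ → above-apart d d′ r<r′ ¬corner))))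

    𝔟-descent : Descent w R
    𝔟-descent = swap-descent (𝔟 (suc k)) (s≤s 1≤k , 1+k<ℓ)
      (𝔟-swaps w R (inj₁ (above , arm-right)))
      -- After the exchange `2 + k` is above the corner and `k` to its right. This is the other
      -- alternative of the same move, which therefore exchanges them back.
      (𝔟-swaps w R′ (inj₂
        ( (c , i , i′ , corner , top , i<i′ , corner-fixed , swap-left ≡k)
        , (i , c , c′ , corner , arm , c<c′ , corner-fixed , swap-right ≡2+k))))
      (swapEntries-sbt (1≤k , ≤-trans (n≤1+n k) (<⇒≤ 1+k<ℓ)) (s≤s z≤n , 1+k<ℓ) balanced′)
      (inv-swap-suc injective k<2+k
        (hook-extremes injective (aboveOf⇒collinear injective above) (rightOf⇒collinear injective arm-right))
        top arm i<i′ (Finₚ.<⇒≢ c<c′) ≡k ≡2+k)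
      where
      above : AboveOf w R k (suc k)
      above = c , i , i′ , corner , top , i<i′ , ≡1+k , ≡k
      arm-right : RightOf w R (2 + k) (suc k)
      arm-right = i , c , c′ , corner , arm , c<c′ , ≡1+k , ≡2+k
      1≤k : 1 ≤ k
      1≤k = subst (1 ≤_) ≡k (proj₁ (inRange i′ c top))
      1+k<ℓ : suc k < ℓ w
      1+k<ℓ = subst (_≤ ℓ w) ≡2+k (proj₂ (inRange i c′ arm))

  -- Search for the last descent

  -- The invariant of the search: no descent at `m` or beyond. It is stated for arbitrary pairs of
  -- entries, not only consecutive ones, because the row of `2 + k` is later squeezed between two
  -- entries that need not be its neighbours.
  RisingFrom : ℕ → Set
  RisingFrom m = ∀ {i c i′ c′} → InD w i c → InD w i′ c′ →
                 m ≤ R i c → R i c ≤ R i′ c′ → i Fin.≤ i′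

  rising-step : ∀ {k i c i′ c′} → InD w i c → InD w i′ c′ → R i c ≡ k → R i′ c′ ≡ suc k →
                i Fin.≤ i′ → RisingFrom (suc k) → RisingFrom k
  rising-step {k} d d′ ≡k ≡1+k i≤i′ rising {r} {e} {r′} {e′} dr dr′ k≤ ≤r′ with m≤n⇒m<n∨m≡n k≤
  ... | inj₁ k<   = rising dr dr′ k< ≤r′
  ... | inj₂ refl with injective _ _ _ _ d dr ≡k | m≤n⇒m<n∨m≡n ≤r′
  ...   | refl , refl | inj₁ k<r′ =
          ≤-trans i≤i′ (rising d′ dr′ (≤-reflexive (sym ≡1+k)) (subst (_≤ R r′ e′) (sym ≡1+k) k<r′))
  ...   | refl , refl | inj₂ eq   = ≤-reflexive (cong toℕ (proj₁ (injective _ _ _ _ dr dr′ eq)))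

  module _ (perm : IsPerm n w) where

    module _ {k : ℕ} {x y z : Fin n} (z<y : z Fin.< y) (y<x : y Fin.< x)
             (wx<wy : w x Fin.< w y) (wx<wz : w x Fin.< w z)
             (≡k : R y (w x) ≡ k) (≡1+k : R z (w x) ≡ suc k) (rising : RisingFrom (suc k)) where

      private
        corner : InD w z (w x)
        corner = x , <-trans z<y y<x , wx<wz , refl

        arm : InD w z (w y)
        arm = descent-cell perm balanced injective z<y y<x wx<wy wx<wz ≡k ≡1+k

        2+k≤arm : 2 + k ≤ R z (w y)
        2+k≤arm = descent-cell-≥ perm balanced injective z<y y<x wx<wy wx<wz ≡k ≡1+k

      -- Row `z` contains `suc k` and, in the arm, an entry of at least `2 + k`. Rows rise between
      -- these entries, so `2 + k` lies in row `z` as well, and `descent-next` then identifies its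
      -- column.
      rising⇒arm : R z (w y) ≡ 2 + k
      rising⇒arm with surjective (2 + k) (s≤s z≤n) (≤-trans 2+k≤arm (proj₂ (inRange z (w y) arm)))
      ... | r , _ , next@(u , r<u , wu<wr , refl) , ≡2+k with r≡z
        where
        r≡z : r ≡ z
        r≡z = toℕ-injective (≤-antisym
          (rising next arm (subst (suc k ≤_) (sym ≡2+k) (n≤1+n _))
                           (subst (_≤ R z (w y)) (sym ≡2+k) 2+k≤arm))
          (rising corner next (≤-reflexive (sym ≡1+k)) (subst₂ _≤_ (sym ≡1+k) (sym ≡2+k) (n≤1+n _))))
      ... | refl = subst (λ v → R z (w v) ≡ 2 + k)
                     (descent-next perm balanced injective z<y y<x wx<wy wx<wz ≡k ≡1+k r<u wu<wr ≡2+k)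
                     ≡2+k

      column-descent : Descent w R
      column-descent = 𝔟-descent corner (x , y<x , wx<wy , refl) arm z<y wx<wy ≡k ≡1+k rising⇒arm

    descent-or-rising-from : ∀ m → suc m ≤ ℓ w → RisingFrom (suc m) → Descent w R ⊎ RisingFrom 1
    descent-or-rising-from zero    _ rising = inj₂ rising
    descent-or-rising-from (suc m) 2+m≤ℓ rising
      with surjective (suc m) (s≤s z≤n) (<⇒≤ 2+m≤ℓ) | surjective (2 + m) (s≤s z≤n) 2+m≤ℓ
    ... | i , c , d , eq | i′ , c′ , d′ , eq′ with i Fin.≤? i′ | c Fin.≟ c′
    ...   | yes i≤i′ | _ = descent-or-rising-from m (<⇒≤ 2+m≤ℓ) (rising-step d d′ eq eq′ i≤i′ rising)
    ...   | no i≰i′ | no c≢c′ = inj₁ (𝔠-descent d d′ eq eq′ (≰⇒> i≰i′) c≢c′)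
    -- Opening the membership proofs names the common column `w x`; rows `i` and `i′` then play the
    -- roles of `y` and `z`.
    descent-or-rising-from (suc m) _ rising
        | i , _ , (x , i<x , wx<wi , refl) , eq | i′ , _ , (_ , _ , wx′<wi′ , wx′≡wx) , eq′
          | no i≰i′ | yes refl =
          inj₁ (column-descent (≰⇒> i≰i′) i<x wx<wi (subst (Fin._< w i′) wx′≡wx wx′<wi′) eq eq′ rising)

    descent-or-rising : Descent w R ⊎ RisingFrom 1
    descent-or-rising = from-top (ℓ w) refl
      where
      from-top : ∀ l → ℓ w ≡ l → Descent w R ⊎ RisingFrom 1
      from-top zero ℓ≡0 = inj₂ λ {i} {c} d _ 1≤ _ →
        contradiction (≤-trans 1≤ (proj₂ (inRange i c d))) (λ 1≤ℓ → ≤⇒≯ (≤-reflexive ℓ≡0) 1≤ℓ)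
      -- The search starts at the largest entry: only one cell has an entry of at least `ℓ w`, so
      -- rising from there is immediate.
      from-top (suc l) ℓ≡1+l = descent-or-rising-from l (≤-reflexive (sym ℓ≡1+l))
        λ {i} {c} {i′} {c′} d d′ 1+l≤ ≤′ → ≤-reflexive (cong toℕ (proj₁ (injective _ _ _ _ d d′
          (≤-antisym ≤′ (≤-trans (proj₂ (inRange i′ c′ d′)) (≤-trans (≤-reflexive ℓ≡1+l) 1+l≤))))))

  module _ (rising : RisingFrom 1) where

    rising-rows : ∀ {i c i′ c′} → InD w i c → InD w i′ c′ → i Fin.< i′ → R i c < R i′ c′
    rising-rows {i} {c} {i′} {c′} d d′ i<i′ =
      ≰⇒> λ ≥ → ≤⇒≯ (rising d′ d (proj₁ (inRange i′ c′ d′)) ≥) i<i′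

    -- Once rows rise, everything above a cell in its column is larger than its entry. Balance then
    -- leaves nothing larger to its right, so each row increases when read from right to left.
    rising-sorted : ∀ {i c i′ c′} → InD w i c → InD w i′ c′ → ReadBefore i c i′ c′ → R i c < R i′ c′
    rising-sorted d d′ (inj₁ i<i′) = rising-rows d d′ i<i′
    rising-sorted {i} {c} {.i} {c′} d d′ (inj₂ (refl , c′<c)) = ≤∧≢⇒<
      (≮⇒≥ λ lt → count-none⁻ (λ e → c′ Fin.<? e ×-dec InD? w i e ×-dec R i c′ <? R i e)
        (allFin-enum n) (trans (balanced i c′ d′) none-above) (c′<c , d , lt))
      (λ eq → Finₚ.<⇒≢ c′<c (sym (proj₂ (injective _ _ _ _ d d′ eq))))
      where
      none-above : aboveSmaller w R i c′ ≡ 0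
      none-above = count-none (λ r → i Fin.<? r ×-dec InD? w r c′ ×-dec R r c′ <? R i c′) (allFin n)
        λ { (i<r , d″ , lt) → <-asym lt (rising-rows d′ d″ i<r) }

    rising-inv : inv w R ≡ 0
    rising-inv = count-none (InvPair? w R) (cartesianProduct (pairs n) (pairs n))
      λ { (d , d′ , lt , i′<i , _) → <-asym lt (rising-rows d′ d i′<i) }

-- Reaching every balanced tableau in the least number of moves

module _ {n : ℕ} {w : Fin n → Fin n} (perm : IsPerm n w) where

  reachable : ∀ m (R : Filling n) → IsSBT w R → inv w R ≡ m →
    ∃[ fs ] (All (ValidMove w) fs × length fs ≡ m × applyMoves w fs (superYamanouchi w) ≈[ w ] R)
  reachable m R sbt inv≡m with descent-or-rising sbt perm
  reachable m R sbt inv≡m | inj₂ rising =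
    [] , [] , trans (sym (rising-inv sbt rising)) inv≡m ,
    sorted⇒superYamanouchi w sbt (rising-sorted sbt rising)
  reachable zero R sbt inv≡0 | inj₁ descent =
    contradiction (trans (Descent.inv-suc descent) inv≡0) (λ ())
  reachable (suc m) R sbt inv≡1+m | inj₁ descent
    with reachable m _ (Descent.sbt descent) (suc-injective (trans (Descent.inv-suc descent) inv≡1+m))
  ... | fs , valid , len , reach =
    fs ∷ʳ move , ∷ʳ⁺ valid (Descent.valid descent) ,
    trans (length-++ fs) (trans (+-comm (length fs) 1) (cong suc len)) ,
    λ i c d → trans (cong (λ S → S i c) (foldl-++ (λ S f → applyMove w f S) (superYamanouchi w) fs [ move ]))
      (trans (applyMove-cong w move reach i c d) (Descent.undo descent i c d))
    where
    move : Move
    move = Descent.move descent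

theorem3p15 : (n : ℕ) (w : Fin n → Fin n) → IsPerm n w →
    (R : Filling n) → IsSBT w R →
    (∃[ fs ] (All (ValidMove w) fs × length fs ≡ inv w R
    × applyMoves w fs (superYamanouchi w) ≈[ w ] R))
    × (∀ (gs : List Move) → All (ValidMove w) gs →
    applyMoves w gs (superYamanouchi w) ≈[ w ] R → inv w R ≤ length gs)
theorem3p15 n w perm R sbt = reachable perm (inv w R) R sbt refl , minimal
  where
  minimal : ∀ (gs : List Move) → All (ValidMove w) gs →
            applyMoves w gs (superYamanouchi w) ≈[ w ] R → inv w R ≤ length gs
  minimal gs valid reach = subst₂ _≤_ (inv-cong w reach)
    (trans (cong (length gs +_) (inv-superYamanouchi w)) (+-identityʳ (length gs)))
    (inv-applyMoves-≤ w gs valid (superYamanouchi w) (superYamanouchi-injective w))
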